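{- Let $\mathbf{k}=(k_1,\dots,k_m)$ be an index and $t$ an indeterminate. Then $$\sum_{i=0}^{\infty}\left(\widetilde{\pounds}_{\widehat{\mathcal{A}},(\{1\}^i,\mathbf{k})}^{\star}(t)-\frac12\zeta_{\widehat{\mathcal{A}}}^{\star}(\{1\}^i,\mathbf{k})\right)\boldsymbol{p}^i=\sum_{i=0}^{\infty}\left(\widetilde{\pounds}_{\widehat{\mathcal{A}},(\{1\}^i,\mathbf{k}^{\vee})}^{\star}(1-t)-\frac12\zeta_{\widehat{\mathcal{A}}}^{\star}(\{1\}^i,\mathbf{k}^{\vee})\right)\boldsymbol{p}^i$$ in the ring $\widehat{\mathcal{A}}_{\mathbb{Z}[t]}=\varprojlim_n\left(\prod_p(\mathbb{Z}/p^n\mathbb{Z})[t]\right)/\left(\bigoplus_p(\mathbb{Z}/p^n\mathbb{Z})[t]\right)$.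
   Context: An index is a tuple $\mathbf{k}=(k_1,\dots,k_m)$ of positive integers ($m\ge 1$). $(\{1\}^i,\mathbf{k})$ denotes $(\underbrace{1,\dots,1}_{i},k_1,\dots,k_m)$. Hoffman dual: let $W$ be the free monoid on $\{0,1\}$. To an index $\mathbf{k}$ associate the word $w(\mathbf{k})=\underbrace{0\cdots0}_{k_1-1}1\underbrace{0\cdots0}_{k_2-1}1\cdots1\underbrace{0\cdots0}_{k_m-1}1$; $w$ is a bijection from the set of all indices onto $W1$ (words ending in $1$). Let $\tau\colon W\to W$ be the monoid homomorphism with $\tau(0)=1$, $\tau(1)=0$. The Hoffman dual $\mathbf{k}^{\vee}$ is the index determined by $w(\mathbf{k}^{\vee})=\tau(w(\mathbf{k})1^{ -1})1$ (delete the last letter $1$, exchange $0$ and $1$, append $1$). Rings: in $\widehat{\mathcal{A}}_{\mathbb{Z}[t]}$, $p$ runs over all prime numbers. Each quotient $\mathcal{A}_{n,\mathbb{Z}[t]}=\left(\prod_p(\mathbb{Z}/p^n\mathbb{Z})[t]\right)/\left(\bigoplus_p(\mathbb{Z}/p^n\mathbb{Z})[t]\right)$ is discrete and $\widehat{\mathcal{A}}_{\mathbb{Z}[t]}$ has the projective limit topology; it is a $\mathbb{Q}$-algebra. There is a natural surjection $\pi\colon\prod_p\widehat{\mathbb{Z}[t]}_p\to\widehat{\mathcal{A}}_{\mathbb{Z}[t]}$, where $\widehat{\mathbb{Z}[t]}_p=\varprojlim_n\mathbb{Z}[t]/p^n\mathbb{Z}[t]$, induced by reduction mod $p^n$ in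 each component; since components at finitely many primes do not matter, $\pi$ may be applied to families defined for all but finitely many $p$. Put $\boldsymbol{p}=\pi((p)_p)$. The topology is the $\boldsymbol{p}$-adic topology, for which the ring is complete, and infinite sums are taken in this topology. Finite star-multiple polylogarithms and zeta-star values: for an index $\mathbf{k}=(k_1,\dots,k_m)$, $$\widetilde{\pounds}_{\widehat{\mathcal{A}},\mathbf{k}}^{\star}(t)=\pi\left(\left(\sum_{p-1\ge n_1\ge\cdots\ge n_m\ge1}\frac{t^{n_m}}{n_1^{k_1}\cdots n_m^{k_m}}\right)_p\right),\qquad \zeta_{\widehat{\mathcal{A}}}^{\star}(\mathbf{k})=\pi\left(\left(\sum_{p-1\ge n_1\ge\cdots\ge n_m\ge1}\frac{1}{n_1^{k_1}\cdots n_m^{k_m}}\right)_p\right),$$ as elements of $\widehat{\mathcal{A}}_{\mathbb{Z}[t]}$; $\widetilde{\pounds}_{\widehat{\mathcal{A}},\mathbf{k}}^{\star}(1-t)$ is obtained by substituting $1-t$ for $t$ in every $p$-component. -}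

module Defs where

open import Algebra.Bundles using (CommutativeRing; CommutativeMonoid)
open import Algebra.Morphism.Bundles using (RingHomomorphism)
import Algebra.Properties.CommutativeSemigroup as CommutativeSemigroupProperties
import Algebra.Properties.Monoid.Sum as MonoidSum
import Algebra.Properties.Ring as RingProperties
import Algebra.Properties.Semiring.Exp as SemiringExp
import Algebra.Properties.Semiring.Mult as SemiringMult
open import Data.Bool.Base using (Bool; true; false; not)
open import Data.Fin.Base using (toℕ)
open import Data.Integer.Base as ℤ using (ℤ; +_)
import Data.Integer.Properties as ℤ
open import Data.Integer.Divisibility.Signed as ℤ∣ using (divides)
import Data.Integer.Tactic.RingSolver as ℤSolver
open import Data.List.Base as List using (List; []; _∷_; _++_; _∷ʳ_; replicate)
open import Data.List.NonEmpty.Base as List⁺ using (List⁺; _∷_; _∷⁺_; _++⁺_; toList)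
open import Data.Nat.Base as ℕ using (ℕ; zero; suc; pred; NonZero; _∸_; _<_)
import Data.Nat.Properties as ℕ
open import Data.Nat.Coprimality as Coprimality using (Coprime; coprime⇒GCD≡1; coprime-divisor)
import Data.Nat.Divisibility as ℕ∣
open import Data.Nat.GCD using (GCD; module Bézout)
open import Data.Nat.Primality using (Prime; prime?; prime⇒irreducible)
open import Data.Product.Base using (_,_; ∃)
open import Data.Sum.Base using (inj₁; inj₂)
open import Function.Base using (_∘_)
open import Level using (Level; _⊔_; 0ℓ)
open import Relation.Binary.PropositionalEquality.Core as ≡ using (_≡_)
import Relation.Binary.PropositionalEquality.Properties as ≡
import Relation.Binary.Reasoning.Setoid as SetoidReasoning
open import Relation.Binary.Structures using (IsEquivalence)
open import Relation.Nullary.Decidable.Core using (Dec; yes; no; recompute)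
open import Relation.Nullary.Negation using (¬_; contradiction)

private
  variable
    c ℓ : Level

------------------------------------------------------------------------
-- Indices and the Hoffman dual

record ℕ⁺ : Set where
  constructor pos
  field
    value       : ℕ
    .{{nonZero}} : NonZero value

open ℕ⁺ public using (value)

Index : Set
Index = List⁺ ℕ⁺

⟨1⟩^_,_ : ℕ → Index → Index
⟨1⟩^ i , k = replicate i (pos 1) ++⁺ k

Letter : Set
Letter = Bool

pattern 𝟎 = false
pattern 𝟏 = true

Word : Set
Word = List Letter

w : Index → Word
w k = List.concatMap (λ kⱼ → replicate (pred (value kⱼ)) 𝟎 ∷ʳ 𝟏) (toList k)

dropLast : Word → Word
dropLast []          = []
dropLast (_ ∷ [])    = []
dropLast (x ∷ y ∷ u) = x ∷ dropLast (y ∷ u)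

τ : Word → Word
τ = List.map not

increment : Index → Index
increment (pos n ∷ ks) = pos (suc n) ∷ ks

-- The index whose word is u 1; see w-w⁻¹ and w⁻¹-w.
w⁻¹[_1] : Word → Index
w⁻¹[ []     1] = pos 1 ∷ []
w⁻¹[ 𝟎 ∷ u 1] = increment w⁻¹[ u 1]
w⁻¹[ 𝟏 ∷ u 1] = pos 1 ∷⁺ w⁻¹[ u 1]

infix 9 _∨

_∨ : Index → Index
k ∨ = w⁻¹[ τ (dropLast (w k)) 1]

private
  w-increment : ∀ k → w (increment k) ≡ 𝟎 ∷ w k
  w-increment (pos (suc n) ∷ ks) = ≡.refl

w-w⁻¹ : ∀ u → w w⁻¹[ u 1] ≡ u ∷ʳ 𝟏
w-w⁻¹ []      = ≡.refl
w-w⁻¹ (𝟎 ∷ u) = ≡.trans (w-increment w⁻¹[ u 1]) (≡.cong (𝟎 ∷_) (w-w⁻¹ u))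
w-w⁻¹ (𝟏 ∷ u) = ≡.cong (𝟏 ∷_) (w-w⁻¹ u)

private
  w⁻¹-w′ : ∀ n ks → w⁻¹[ dropLast (w (pos (suc n) ∷ ks)) 1] ≡ pos (suc n) ∷ ks
  w⁻¹-w′ zero    []       = ≡.refl
  w⁻¹-w′ zero    (pos (suc zero)    ∷ ks) = ≡.cong (pos 1 ∷⁺_) (w⁻¹-w′ zero ks)
  w⁻¹-w′ zero    (pos (suc (suc n)) ∷ ks) = ≡.cong (pos 1 ∷⁺_) (w⁻¹-w′ (suc n) ks)
  w⁻¹-w′ (suc n) ks       = ≡.trans (≡.cong w⁻¹[_1] (step n)) (≡.cong increment (w⁻¹-w′ n ks))
    where
    step : ∀ n → dropLast (w (pos (suc (suc n)) ∷ ks)) ≡ 𝟎 ∷ dropLast (w (pos (suc n) ∷ ks))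
    step zero    = ≡.refl
    step (suc n) = ≡.refl

w⁻¹-w : ∀ k → w⁻¹[ dropLast (w k) 1] ≡ k
w⁻¹-w (pos (suc n) ∷ ks) = w⁻¹-w′ n ks

w-∨ : ∀ k → w (k ∨) ≡ τ (dropLast (w k)) ∷ʳ 𝟏
w-∨ k = w-w⁻¹ (τ (dropLast (w k)))

------------------------------------------------------------------------
-- Polynomials in one indeterminate

-- A polynomial is its list of coefficients, constant term first; trailing
-- zeros are immaterial for _≈ₚ_.
module Polynomial (R : CommutativeRing c ℓ) where
  open CommutativeRing R
  open RingProperties ring using (-0#≈0#)

  Poly : Set c
  Poly = List Carrier

  coeff : Poly → ℕ → Carrier
  coeff []      _       = 0#
  coeff (a ∷ f) zero    = a
  coeff (a ∷ f) (suc n) = coeff f n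

  infix 4 _≈ₚ_

  record _≈ₚ_ (f g : Poly) : Set ℓ where
    constructor coeffwise
    field coeff≈ : ∀ n → coeff f n ≈ coeff g n

  open _≈ₚ_ public

  infixl 6 _+ₚ_
  infixl 7 _*ₚ_ _·_
  infix  8 -ₚ_

  _+ₚ_ : Poly → Poly → Poly
  []      +ₚ g       = g
  (a ∷ f) +ₚ []      = a ∷ f
  (a ∷ f) +ₚ (b ∷ g) = (a + b) ∷ (f +ₚ g)

  -ₚ_ : Poly → Poly
  -ₚ_ = List.map (-_)

  _·_ : Carrier → Poly → Poly
  a · f = List.map (a *_) f

  _*ₚ_ : Poly → Poly → Poly
  []      *ₚ g = []
  (a ∷ f) *ₚ g = a · g +ₚ (0# ∷ f *ₚ g)

  constant : Carrier → Poly
  constant a = a ∷ []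

  indeterminate : Poly
  indeterminate = 0# ∷ 1# ∷ []

  coeff-+ : ∀ f g n → coeff (f +ₚ g) n ≈ coeff f n + coeff g n
  coeff-+ []      g       n       = sym (+-identityˡ _)
  coeff-+ (a ∷ f) []      n       = sym (+-identityʳ _)
  coeff-+ (a ∷ f) (b ∷ g) zero    = refl
  coeff-+ (a ∷ f) (b ∷ g) (suc n) = coeff-+ f g n

  coeff-- : ∀ f n → coeff (-ₚ f) n ≈ - coeff f n
  coeff-- []      n       = sym -0#≈0#
  coeff-- (a ∷ f) zero    = refl
  coeff-- (a ∷ f) (suc n) = coeff-- f n

  coeff-· : ∀ a f n → coeff (a · f) n ≈ a * coeff f n
  coeff-· a []      n       = sym (zeroʳ a)
  coeff-· a (b ∷ f) zero    = refl
  coeff-· a (b ∷ f) (suc n) = coeff-· a f n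

  ≈ₚ-isEquivalence : IsEquivalence _≈ₚ_
  ≈ₚ-isEquivalence = record
    { refl  = coeffwise λ _ → refl
    ; sym   = λ p → coeffwise λ n → sym (coeff≈ p n)
    ; trans = λ p q → coeffwise λ n → trans (coeff≈ p n) (coeff≈ q n)
    }

  +ₚ-cong : ∀ {f f′ g g′} → f ≈ₚ f′ → g ≈ₚ g′ → f +ₚ g ≈ₚ f′ +ₚ g′
  +ₚ-cong {f} {f′} {g} {g′} p q = coeffwise λ n →
    trans (coeff-+ f g n)
      (trans (+-cong (coeff≈ p n) (coeff≈ q n)) (sym (coeff-+ f′ g′ n)))

  +ₚ-assoc : ∀ f g h → (f +ₚ g) +ₚ h ≈ₚ f +ₚ (g +ₚ h)
  +ₚ-assoc f g h = coeffwise λ n → begin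
    coeff ((f +ₚ g) +ₚ h) n             ≈⟨ coeff-+ (f +ₚ g) h n ⟩
    coeff (f +ₚ g) n + coeff h n        ≈⟨ +-congʳ (coeff-+ f g n) ⟩
    (coeff f n + coeff g n) + coeff h n ≈⟨ +-assoc _ _ _ ⟩
    coeff f n + (coeff g n + coeff h n) ≈⟨ +-congˡ (coeff-+ g h n) ⟨
    coeff f n + coeff (g +ₚ h) n        ≈⟨ coeff-+ f (g +ₚ h) n ⟨
    coeff (f +ₚ (g +ₚ h)) n             ∎
    where open SetoidReasoning setoid

  +ₚ-comm : ∀ f g → f +ₚ g ≈ₚ g +ₚ f
  +ₚ-comm f g = coeffwise λ n →
    trans (coeff-+ f g n) (trans (+-comm _ _) (sym (coeff-+ g f n)))

  +ₚ-identityʳ : ∀ f → f +ₚ [] ≈ₚ f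
  +ₚ-identityʳ f = coeffwise λ n → trans (coeff-+ f [] n) (+-identityʳ _)

  -ₚ-inverseʳ : ∀ f → f +ₚ -ₚ f ≈ₚ []
  -ₚ-inverseʳ f = coeffwise λ n →
    trans (coeff-+ f (-ₚ f) n) (trans (+-congˡ (coeff-- f n)) (-‿inverseʳ _))

  -ₚ-cong : ∀ {f g} → f ≈ₚ g → -ₚ f ≈ₚ -ₚ g
  -ₚ-cong {f} {g} p = coeffwise λ n →
    trans (coeff-- f n) (trans (-‿cong (coeff≈ p n)) (sym (coeff-- g n)))

  +ₚ-commutativeMonoid : CommutativeMonoid c ℓ
  +ₚ-commutativeMonoid = record
    { Carrier = Poly ; _≈_ = _≈ₚ_ ; _∙_ = _+ₚ_ ; ε = []
    ; isCommutativeMonoid = record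
      { isMonoid = record
        { isSemigroup = record
          { isMagma = record { isEquivalence = ≈ₚ-isEquivalence ; ∙-cong = +ₚ-cong }
          ; assoc = +ₚ-assoc }
        ; identity = (λ _ → coeffwise λ _ → refl) , +ₚ-identityʳ }
      ; comm = +ₚ-comm }
    }

  private
    module P = CommutativeMonoid +ₚ-commutativeMonoid
    open CommutativeSemigroupProperties P.commutativeSemigroup
      using (interchange; x∙yz≈y∙xz)

  ∷-cong : ∀ {a b f g} → a ≈ b → f ≈ₚ g → a ∷ f ≈ₚ b ∷ g
  ∷-cong p q = coeffwise λ { zero → p ; (suc n) → coeff≈ q n }

  0∷[]≈[] : 0# ∷ [] ≈ₚ []
  0∷[]≈[] = coeffwise λ { zero → refl ; (suc n) → refl }

  0∷-+ : ∀ f g → 0# ∷ (f +ₚ g) ≈ₚ (0# ∷ f) +ₚ (0# ∷ g)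
  0∷-+ f g = ∷-cong (sym (+-identityʳ 0#)) P.refl

  ·-cong : ∀ {a b f g} → a ≈ b → f ≈ₚ g → a · f ≈ₚ b · g
  ·-cong {a} {b} {f} {g} p q = coeffwise λ n →
    trans (coeff-· a f n) (trans (*-cong p (coeff≈ q n)) (sym (coeff-· b g n)))

  ·-distribˡ : ∀ a f g → a · (f +ₚ g) ≈ₚ a · f +ₚ a · g
  ·-distribˡ a f g = coeffwise λ n → begin
    coeff (a · (f +ₚ g)) n            ≈⟨ coeff-· a (f +ₚ g) n ⟩
    a * coeff (f +ₚ g) n              ≈⟨ *-congˡ (coeff-+ f g n) ⟩
    a * (coeff f n + coeff g n)       ≈⟨ distribˡ a _ _ ⟩
    a * coeff f n + a * coeff g n     ≈⟨ +-cong (coeff-· a f n) (coeff-· a g n) ⟨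
    coeff (a · f) n + coeff (a · g) n ≈⟨ coeff-+ (a · f) (a · g) n ⟨
    coeff (a · f +ₚ a · g) n          ∎
    where open SetoidReasoning setoid

  ·-assoc : ∀ a b f → (a * b) · f ≈ₚ a · (b · f)
  ·-assoc a b f = coeffwise λ n → begin
    coeff ((a * b) · f) n ≈⟨ coeff-· (a * b) f n ⟩
    a * b * coeff f n     ≈⟨ *-assoc a b _ ⟩
    a * (b * coeff f n)   ≈⟨ *-congˡ (coeff-· b f n) ⟨
    a * coeff (b · f) n   ≈⟨ coeff-· a (b · f) n ⟨
    coeff (a · (b · f)) n ∎
    where open SetoidReasoning setoid

  0·f≈[] : ∀ f → 0# · f ≈ₚ []
  0·f≈[] f = coeffwise λ n → trans (coeff-· 0# f n) (zeroˡ _)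

  1·f≈f : ∀ f → 1# · f ≈ₚ f
  1·f≈f f = coeffwise λ n → trans (coeff-· 1# f n) (*-identityˡ _)

  *ₚ-congˡ : ∀ f {g g′} → g ≈ₚ g′ → f *ₚ g ≈ₚ f *ₚ g′
  *ₚ-congˡ []      p = P.refl
  *ₚ-congˡ (a ∷ f) p = +ₚ-cong (·-cong refl p) (∷-cong refl (*ₚ-congˡ f p))

  *ₚ-zeroʳ : ∀ f → f *ₚ [] ≈ₚ []
  *ₚ-zeroʳ []      = P.refl
  *ₚ-zeroʳ (a ∷ f) = P.trans (∷-cong refl (*ₚ-zeroʳ f)) 0∷[]≈[]

  *ₚ-∷ : ∀ f b g → f *ₚ (b ∷ g) ≈ₚ b · f +ₚ (0# ∷ f *ₚ g)
  *ₚ-∷ []      b g = P.sym 0∷[]≈[]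
  *ₚ-∷ (a ∷ f) b g = ∷-cong (+-congʳ (*-comm a b)) (begin
    a · g +ₚ f *ₚ (b ∷ g)              ≈⟨ +ₚ-cong P.refl (*ₚ-∷ f b g) ⟩
    a · g +ₚ (b · f +ₚ (0# ∷ f *ₚ g))  ≈⟨ x∙yz≈y∙xz (a · g) (b · f) _ ⟩
    b · f +ₚ (a · g +ₚ (0# ∷ f *ₚ g))  ∎)
    where open SetoidReasoning P.setoid

  *ₚ-comm : ∀ f g → f *ₚ g ≈ₚ g *ₚ f
  *ₚ-comm []      g = P.sym (*ₚ-zeroʳ g)
  *ₚ-comm (a ∷ f) g =
    P.trans (+ₚ-cong P.refl (∷-cong refl (*ₚ-comm f g))) (P.sym (*ₚ-∷ g a f))

  *ₚ-cong : ∀ {f f′ g g′} → f ≈ₚ f′ → g ≈ₚ g′ → f *ₚ g ≈ₚ f′ *ₚ g′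
  *ₚ-cong {f} {f′} {g} {g′} p q = begin
    f *ₚ g   ≈⟨ *ₚ-congˡ f q ⟩
    f *ₚ g′  ≈⟨ *ₚ-comm f g′ ⟩
    g′ *ₚ f  ≈⟨ *ₚ-congˡ g′ p ⟩
    g′ *ₚ f′ ≈⟨ *ₚ-comm g′ f′ ⟩
    f′ *ₚ g′ ∎
    where open SetoidReasoning P.setoid

  *ₚ-distribˡ : ∀ f g h → f *ₚ (g +ₚ h) ≈ₚ f *ₚ g +ₚ f *ₚ h
  *ₚ-distribˡ []      g h = P.refl
  *ₚ-distribˡ (a ∷ f) g h = begin
    a · (g +ₚ h) +ₚ (0# ∷ f *ₚ (g +ₚ h))
      ≈⟨ +ₚ-cong (·-distribˡ a g h) (∷-cong refl (*ₚ-distribˡ f g h)) ⟩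
    (a · g +ₚ a · h) +ₚ (0# ∷ (f *ₚ g +ₚ f *ₚ h))
      ≈⟨ +ₚ-cong P.refl (0∷-+ (f *ₚ g) (f *ₚ h)) ⟩
    (a · g +ₚ a · h) +ₚ ((0# ∷ f *ₚ g) +ₚ (0# ∷ f *ₚ h))
      ≈⟨ interchange (a · g) (a · h) _ _ ⟩
    (a · g +ₚ (0# ∷ f *ₚ g)) +ₚ (a · h +ₚ (0# ∷ f *ₚ h)) ∎
    where open SetoidReasoning P.setoid

  *ₚ-distribʳ : ∀ h f g → (f +ₚ g) *ₚ h ≈ₚ f *ₚ h +ₚ g *ₚ h
  *ₚ-distribʳ h f g = begin
    (f +ₚ g) *ₚ h    ≈⟨ *ₚ-comm (f +ₚ g) h ⟩
    h *ₚ (f +ₚ g)    ≈⟨ *ₚ-distribˡ h f g ⟩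
    h *ₚ f +ₚ h *ₚ g ≈⟨ +ₚ-cong (*ₚ-comm h f) (*ₚ-comm h g) ⟩
    f *ₚ h +ₚ g *ₚ h ∎
    where open SetoidReasoning P.setoid

  ·-*ₚ-assoc : ∀ a f g → (a · f) *ₚ g ≈ₚ a · (f *ₚ g)
  ·-*ₚ-assoc a []      g = P.refl
  ·-*ₚ-assoc a (b ∷ f) g = begin
    (a * b) · g +ₚ (0# ∷ (a · f) *ₚ g)
      ≈⟨ +ₚ-cong (·-assoc a b g) (∷-cong (sym (zeroʳ a)) (·-*ₚ-assoc a f g)) ⟩
    a · (b · g) +ₚ a · (0# ∷ f *ₚ g)
      ≈⟨ ·-distribˡ a (b · g) (0# ∷ f *ₚ g) ⟨
    a · (b · g +ₚ (0# ∷ f *ₚ g)) ∎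
    where open SetoidReasoning P.setoid

  *ₚ-assoc : ∀ f g h → (f *ₚ g) *ₚ h ≈ₚ f *ₚ (g *ₚ h)
  *ₚ-assoc []      g h = P.refl
  *ₚ-assoc (a ∷ f) g h = begin
    (a · g +ₚ (0# ∷ f *ₚ g)) *ₚ h
      ≈⟨ *ₚ-distribʳ h (a · g) (0# ∷ f *ₚ g) ⟩
    (a · g) *ₚ h +ₚ (0# · h +ₚ (0# ∷ (f *ₚ g) *ₚ h))
      ≈⟨ +ₚ-cong (·-*ₚ-assoc a g h) (+ₚ-cong (0·f≈[] h) (∷-cong refl (*ₚ-assoc f g h))) ⟩
    a · (g *ₚ h) +ₚ (0# ∷ f *ₚ (g *ₚ h)) ∎
    where open SetoidReasoning P.setoid

  *ₚ-identityˡ : ∀ f → constant 1# *ₚ f ≈ₚ f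
  *ₚ-identityˡ f = begin
    1# · f +ₚ (0# ∷ []) ≈⟨ +ₚ-cong (1·f≈f f) 0∷[]≈[] ⟩
    f +ₚ []             ≈⟨ +ₚ-identityʳ f ⟩
    f                   ∎
    where open SetoidReasoning P.setoid

infix 9 _[t]

_[t] : CommutativeRing c ℓ → CommutativeRing c ℓ
R [t] = record
  { Carrier = Poly ; _≈_ = _≈ₚ_ ; _+_ = _+ₚ_ ; _*_ = _*ₚ_ ; -_ = -ₚ_
  ; 0# = [] ; 1# = constant 1#
  ; isCommutativeRing = record
    { isRing = record
      { +-isAbelianGroup = record
        { isGroup = record
          { isMonoid = P.isMonoid
          ; inverse  = (λ f → P.trans (+ₚ-comm (-ₚ f) f) (-ₚ-inverseʳ f)) , -ₚ-inverseʳ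
          ; ⁻¹-cong  = -ₚ-cong }
        ; comm = +ₚ-comm }
      ; *-cong     = *ₚ-cong
      ; *-assoc    = *ₚ-assoc
      ; *-identity = *ₚ-identityˡ
                   , λ f → P.trans (*ₚ-comm f (constant 1#)) (*ₚ-identityˡ f)
      ; distrib    = *ₚ-distribˡ , *ₚ-distribʳ }
    ; *-comm = *ₚ-comm }
  }
  where
  open CommutativeRing R using (1#)
  open Polynomial R
  module P = CommutativeMonoid +ₚ-commutativeMonoid

RingHom : CommutativeRing c ℓ → CommutativeRing c ℓ → Set (c ⊔ ℓ)
RingHom R S = RingHomomorphism (CommutativeRing.rawRing R) (CommutativeRing.rawRing S)

module _ (R S : CommutativeRing c ℓ) (φ : RingHom R S) where
  private
    module R  = CommutativeRing R
    module S  = CommutativeRing S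
    module RP = Polynomial R
    module SP = Polynomial S
    module P  = CommutativeMonoid SP.+ₚ-commutativeMonoid
    open RingHomomorphism φ using (⟦_⟧; ⟦⟧-cong; 0#-homo; 1#-homo; +-homo; *-homo; -‿homo)

    map-coeff : ∀ f n → SP.coeff (List.map ⟦_⟧ f) n S.≈ ⟦ RP.coeff f n ⟧
    map-coeff []      n       = S.sym 0#-homo
    map-coeff (a ∷ f) zero    = S.refl
    map-coeff (a ∷ f) (suc n) = map-coeff f n

    map-cong : ∀ {f g} → f RP.≈ₚ g → List.map ⟦_⟧ f SP.≈ₚ List.map ⟦_⟧ g
    map-cong {f} {g} p = SP.coeffwise λ n →
      S.trans (map-coeff f n) (S.trans (⟦⟧-cong (RP.coeff≈ p n)) (S.sym (map-coeff g n)))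

    map-+ : ∀ f g → List.map ⟦_⟧ (f RP.+ₚ g) SP.≈ₚ List.map ⟦_⟧ f SP.+ₚ List.map ⟦_⟧ g
    map-+ []      g       = P.refl
    map-+ (a ∷ f) []      = P.refl
    map-+ (a ∷ f) (b ∷ g) = SP.∷-cong (+-homo a b) (map-+ f g)

    map-- : ∀ f → List.map ⟦_⟧ (RP.-ₚ f) SP.≈ₚ SP.-ₚ (List.map ⟦_⟧ f)
    map-- []      = P.refl
    map-- (a ∷ f) = SP.∷-cong (-‿homo a) (map-- f)

    map-· : ∀ a f → List.map ⟦_⟧ (a RP.· f) SP.≈ₚ ⟦ a ⟧ SP.· List.map ⟦_⟧ f
    map-· a []      = P.refl
    map-· a (b ∷ f) = SP.∷-cong (*-homo a b) (map-· a f)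

    map-* : ∀ f g → List.map ⟦_⟧ (f RP.*ₚ g) SP.≈ₚ List.map ⟦_⟧ f SP.*ₚ List.map ⟦_⟧ g
    map-* []      g = P.refl
    map-* (a ∷ f) g = P.trans (map-+ (a RP.· g) (R.0# ∷ f RP.*ₚ g))
      (SP.+ₚ-cong (map-· a g) (SP.∷-cong 0#-homo (map-* f g)))

  mapCoefficients : RingHom (R [t]) (S [t])
  mapCoefficients = record
    { ⟦_⟧ = List.map ⟦_⟧
    ; isRingHomomorphism = record
      { isSemiringHomomorphism = record
        { isNearSemiringHomomorphism = record
          { +-isMonoidHomomorphism = record
            { isMagmaHomomorphism = record
              { isRelHomomorphism = record { cong = map-cong } ; homo = map-+ }
            ; ε-homo = P.refl }
          ; *-homo = map-* }
        ; 1#-homo = SP.∷-cong 1#-homo P.refl }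
      ; -‿homo = map-- }
    }

------------------------------------------------------------------------
-- The rings ℤ/mℤ and their reduction maps

infix 4 _≡_[mod_]

record _≡_[mod_] (a b : ℤ) (m : ℕ) : Set where
  constructor congruent
  field difference : + m ℤ∣.∣ a ℤ.- b

private
  -- + m ∣ y whenever y is equal to a known multiple of + m
  by : ∀ {m a b} y → + m ℤ∣.∣ y → y ≡ a ℤ.- b → a ≡ b [mod m ]
  by y d ≡.refl = congruent d

  ≡⇒mod : ∀ {m a b} → a ≡ b → a ≡ b [mod m ]
  ≡⇒mod {m} {a} ≡.refl = congruent (divides (+ 0) (ℤ.+-inverseʳ a))

  mod-sym : ∀ {m a b} → a ≡ b [mod m ] → b ≡ a [mod m ]
  mod-sym {a = a} {b} (congruent d) = by (ℤ.- (a ℤ.- b)) (ℤ∣.∣m⇒∣-m d) (lem a b)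
    where
    lem : ∀ a b → ℤ.- (a ℤ.- b) ≡ b ℤ.- a
    lem = ℤSolver.solve-∀

  mod-trans : ∀ {m a b c} → a ≡ b [mod m ] → b ≡ c [mod m ] → a ≡ c [mod m ]
  mod-trans {a = a} {b} {c} (congruent d) (congruent e) =
    by ((a ℤ.- b) ℤ.+ (b ℤ.- c)) (ℤ∣.∣m∣n⇒∣m+n d e) (lem a b c)
    where
    lem : ∀ a b c → (a ℤ.- b) ℤ.+ (b ℤ.- c) ≡ a ℤ.- c
    lem = ℤSolver.solve-∀

  mod-+ : ∀ {m a a′ b b′} → a ≡ a′ [mod m ] → b ≡ b′ [mod m ] → a ℤ.+ b ≡ a′ ℤ.+ b′ [mod m ]
  mod-+ {a = a} {a′} {b} {b′} (congruent d) (congruent e) =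
    by ((a ℤ.- a′) ℤ.+ (b ℤ.- b′)) (ℤ∣.∣m∣n⇒∣m+n d e) (lem a a′ b b′)
    where
    lem : ∀ a a′ b b′ → (a ℤ.- a′) ℤ.+ (b ℤ.- b′) ≡ (a ℤ.+ b) ℤ.- (a′ ℤ.+ b′)
    lem = ℤSolver.solve-∀

  mod-* : ∀ {m a a′ b b′} → a ≡ a′ [mod m ] → b ≡ b′ [mod m ] → a ℤ.* b ≡ a′ ℤ.* b′ [mod m ]
  mod-* {a = a} {a′} {b} {b′} (congruent d) (congruent e) =
    by (b ℤ.* (a ℤ.- a′) ℤ.+ a′ ℤ.* (b ℤ.- b′))
       (ℤ∣.∣m∣n⇒∣m+n (ℤ∣.∣n⇒∣m*n b d) (ℤ∣.∣n⇒∣m*n a′ e)) (lem a a′ b b′)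
    where
    lem : ∀ a a′ b b′ → b ℤ.* (a ℤ.- a′) ℤ.+ a′ ℤ.* (b ℤ.- b′) ≡ (a ℤ.* b) ℤ.- (a′ ℤ.* b′)
    lem = ℤSolver.solve-∀

  mod-- : ∀ {m a b} → a ≡ b [mod m ] → ℤ.- a ≡ ℤ.- b [mod m ]
  mod-- {a = a} {b} (congruent d) = by (ℤ.- (a ℤ.- b)) (ℤ∣.∣m⇒∣-m d) (lem a b)
    where
    lem : ∀ a b → ℤ.- (a ℤ.- b) ≡ (ℤ.- a) ℤ.- (ℤ.- b)
    lem = ℤSolver.solve-∀

infix 10 ℤ/_

ℤ/_ : ℕ → CommutativeRing 0ℓ 0ℓ
ℤ/ m = record
  { Carrier = ℤ ; _≈_ = _≡_[mod m ] ; _+_ = ℤ._+_ ; _*_ = ℤ._*_ ; -_ = ℤ.-_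
  ; 0# = + 0 ; 1# = + 1
  ; isCommutativeRing = record
    { isRing = record
      { +-isAbelianGroup = record
        { isGroup = record
          { isMonoid = record
            { isSemigroup = record
              { isMagma = record
                { isEquivalence = record
                  { refl = ≡⇒mod ≡.refl ; sym = mod-sym ; trans = mod-trans }
                ; ∙-cong = mod-+ }
              ; assoc = λ a b c → ≡⇒mod (ℤ.+-assoc a b c) }
            ; identity = ≡⇒mod ∘ ℤ.+-identityˡ , ≡⇒mod ∘ ℤ.+-identityʳ }
          ; inverse = ≡⇒mod ∘ ℤ.+-inverseˡ , ≡⇒mod ∘ ℤ.+-inverseʳ
          ; ⁻¹-cong = mod-- }
        ; comm = λ a b → ≡⇒mod (ℤ.+-comm a b) }
      ; *-cong = mod-*
      ; *-assoc = λ a b c → ≡⇒mod (ℤ.*-assoc a b c)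
      ; *-identity = ≡⇒mod ∘ ℤ.*-identityˡ , ≡⇒mod ∘ ℤ.*-identityʳ
      ; distrib = (λ a b c → ≡⇒mod (ℤ.*-distribˡ-+ a b c))
                , (λ a b c → ≡⇒mod (ℤ.*-distribʳ-+ a b c)) }
    ; *-comm = λ a b → ≡⇒mod (ℤ.*-comm a b) }
  }

mod-∣ : ∀ {m n a b} → m ℕ∣.∣ n → a ≡ b [mod n ] → a ≡ b [mod m ]
mod-∣ m∣n (congruent d) = congruent (ℤ∣.∣-trans (ℤ∣.∣ᵤ⇒∣ m∣n) d)

reduceℤ : ∀ {m n} → m ℕ∣.∣ n → RingHom (ℤ/ n) (ℤ/ m)
reduceℤ {m} m∣n = record
  { ⟦_⟧ = λ a → a
  ; isRingHomomorphism = record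
    { isSemiringHomomorphism = record
      { isNearSemiringHomomorphism = record
        { +-isMonoidHomomorphism = record
          { isMagmaHomomorphism = record
            { isRelHomomorphism = record { cong = mod-∣ m∣n } ; homo = λ _ _ → refl }
          ; ε-homo = refl }
        ; *-homo = λ _ _ → refl }
      ; 1#-homo = refl }
    ; -‿homo = λ _ → refl }
  }
  where open CommutativeRing (ℤ/ m) using (refl)

------------------------------------------------------------------------
-- Projective limits of rings over ℕ

module ProjectiveLimit
  (R : ℕ → CommutativeRing c ℓ) (φ : ∀ n → RingHom (R (suc n)) (R n)) where

  private
    module R (n : ℕ) = CommutativeRing (R n)
    module φ (n : ℕ) = RingHomomorphism (φ n)

  record Thread : Set (c ⊔ ℓ) where
    field
      at         : ∀ n → R.Carrier n
      compatible : ∀ n → R._≈_ n (φ.⟦_⟧ n (at (suc n))) (at n)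

  open Thread public

  lim : CommutativeRing (c ⊔ ℓ) ℓ
  lim = record
    { Carrier = Thread
    ; _≈_ = λ x y → ∀ n → R._≈_ n (at x n) (at y n)
    ; _+_ = λ x y → record
      { at = λ n → R._+_ n (at x n) (at y n)
      ; compatible = λ n → R.trans n (φ.+-homo n _ _) (R.+-cong n (compatible x n) (compatible y n)) }
    ; _*_ = λ x y → record
      { at = λ n → R._*_ n (at x n) (at y n)
      ; compatible = λ n → R.trans n (φ.*-homo n _ _) (R.*-cong n (compatible x n) (compatible y n)) }
    ; -_ = λ x → record
      { at = λ n → R.-_ n (at x n)
      ; compatible = λ n → R.trans n (φ.-‿homo n _) (R.-‿cong n (compatible x n)) }
    ; 0# = record { at = R.0# ; compatible = φ.0#-homo }
    ; 1# = record { at = R.1# ; compatible = φ.1#-homo }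
    ; isCommutativeRing = record
      { isRing = record
        { +-isAbelianGroup = record
          { isGroup = record
            { isMonoid = record
              { isSemigroup = record
                { isMagma = record
                  { isEquivalence = record
                    { refl  = λ n → R.refl n
                    ; sym   = λ p n → R.sym n (p n)
                    ; trans = λ p q n → R.trans n (p n) (q n) }
                  ; ∙-cong = λ p q n → R.+-cong n (p n) (q n) }
                ; assoc = λ x y z n → R.+-assoc n _ _ _ }
              ; identity = (λ x n → R.+-identityˡ n _) , (λ x n → R.+-identityʳ n _) }
            ; inverse = (λ x n → R.-‿inverseˡ n _) , (λ x n → R.-‿inverseʳ n _)
            ; ⁻¹-cong = λ p n → R.-‿cong n (p n) }
          ; comm = λ x y n → R.+-comm n _ _ }
        ; *-cong = λ p q n → R.*-cong n (p n) (q n)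
        ; *-assoc = λ x y z n → R.*-assoc n _ _ _
        ; *-identity = (λ x n → R.*-identityˡ n _) , (λ x n → R.*-identityʳ n _)
        ; distrib = (λ x y z n → R.distribˡ n _ _ _) , (λ x y z n → R.distribʳ n _ _ _) }
      ; *-comm = λ x y n → R.*-comm n _ _ }
    }

  private module L = CommutativeRing lim
  open MonoidSum L.+-monoid using (sum)

  -- Convergence in the projective limit topology, each R n being discrete:
  -- every component is eventually constant, with the right value.
  _⟶_ : (ℕ → Thread) → Thread → Set ℓ
  x ⟶ y = ∀ n → ∃ λ N → ∀ k → N ℕ.≤ k → R._≈_ n (at (x k) n) (at y n)

  HasSum : (ℕ → Thread) → Thread → Set ℓ
  HasSum a s = (λ k → sum {k} (λ i → a (toℕ i))) ⟶ s

  ⟶-unique : ∀ {x y z} → x ⟶ y → x ⟶ z → y L.≈ z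
  ⟶-unique p q n with p n | q n
  ... | M , p′ | N , q′ =
    R.trans n (R.sym n (p′ (M ℕ.⊔ N) (ℕ.m≤m⊔n M N))) (q′ (M ℕ.⊔ N) (ℕ.m≤n⊔m M N))

------------------------------------------------------------------------
-- Families indexed by the primes, up to finitely many components

record ℙ : Set where
  constructor _,prime_
  field
    number  : ℕ
    .isPrime : Prime number

open ℙ public using (number)

primality : ∀ p → Prime (number p)
primality (p ,prime p-prime) = recompute (prime? p) p-prime

module ModuloFinite (R : ℙ → CommutativeRing c ℓ) where
  private module R (p : ℙ) = CommutativeRing (R p)

  Family : Set c
  Family = ∀ p → R.Carrier p

  -- f − g lies in the direct sum: its components at all large p vanish.
  _≈ₐ_ : Family → Family → Set ℓ
  f ≈ₐ g = ∃ λ N → ∀ p → N < number p → R._≈_ p (f p) (g p)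

  private
    everywhere : ∀ {f g : Family} → (∀ p → R._≈_ p (f p) (g p)) → f ≈ₐ g
    everywhere e = 0 , λ p _ → e p

    cong₂ₐ : ∀ {f f′ g g′ h h′ : Family} →
      (∀ p → R._≈_ p (f p) (f′ p) → R._≈_ p (g p) (g′ p) → R._≈_ p (h p) (h′ p)) →
      f ≈ₐ f′ → g ≈ₐ g′ → h ≈ₐ h′
    cong₂ₐ e (M , p) (N , q) = M ℕ.⊔ N , λ r M⊔N<r → e r
      (p r (ℕ.≤-<-trans (ℕ.m≤m⊔n M N) M⊔N<r)) (q r (ℕ.≤-<-trans (ℕ.m≤n⊔m M N) M⊔N<r))

  ∏/⊕ : CommutativeRing c ℓ
  ∏/⊕ = record
    { Carrier = Family
    ; _≈_ = _≈ₐ_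
    ; _+_ = λ f g p → R._+_ p (f p) (g p)
    ; _*_ = λ f g p → R._*_ p (f p) (g p)
    ; -_  = λ f p → R.-_ p (f p)
    ; 0#  = R.0#
    ; 1#  = R.1#
    ; isCommutativeRing = record
      { isRing = record
        { +-isAbelianGroup = record
          { isGroup = record
            { isMonoid = record
              { isSemigroup = record
                { isMagma = record
                  { isEquivalence = record
                    { refl  = everywhere λ p → R.refl p
                    ; sym   = λ (N , e) → N , λ p N<p → R.sym p (e p N<p)
                    ; trans = cong₂ₐ λ p → R.trans p }
                  ; ∙-cong = cong₂ₐ λ p → R.+-cong p }
                ; assoc = λ f g h → everywhere λ p → R.+-assoc p _ _ _ }
              ; identity = (λ f → everywhere λ p → R.+-identityˡ p _)
                         , (λ f → everywhere λ p → R.+-identityʳ p _) }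
            ; inverse = (λ f → everywhere λ p → R.-‿inverseˡ p _)
                      , (λ f → everywhere λ p → R.-‿inverseʳ p _)
            ; ⁻¹-cong = λ (N , e) → N , λ p N<p → R.-‿cong p (e p N<p) }
          ; comm = λ f g → everywhere λ p → R.+-comm p _ _ }
        ; *-cong = cong₂ₐ λ p → R.*-cong p
        ; *-assoc = λ f g h → everywhere λ p → R.*-assoc p _ _ _
        ; *-identity = (λ f → everywhere λ p → R.*-identityˡ p _)
                     , (λ f → everywhere λ p → R.*-identityʳ p _)
        ; distrib = (λ f g h → everywhere λ p → R.distribˡ p _ _ _)
                  , (λ f g h → everywhere λ p → R.distribʳ p _ _ _) }
      ; *-comm = λ f g → everywhere λ p → R.*-comm p _ _ }
    }

module _ (R S : ℙ → CommutativeRing c ℓ) (φ : ∀ p → RingHom (R p) (S p)) where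
  private
    module S (p : ℙ) = CommutativeRing (S p)
    module φ (p : ℙ) = RingHomomorphism (φ p)

  mapComponents : RingHom (ModuloFinite.∏/⊕ R) (ModuloFinite.∏/⊕ S)
  mapComponents = record
    { ⟦_⟧ = λ f p → φ.⟦_⟧ p (f p)
    ; isRingHomomorphism = record
      { isSemiringHomomorphism = record
        { isNearSemiringHomomorphism = record
          { +-isMonoidHomomorphism = record
            { isMagmaHomomorphism = record
              { isRelHomomorphism = record
                { cong = λ (N , e) → N , λ p N<p → φ.⟦⟧-cong p (e p N<p) }
              ; homo = λ f g → 0 , λ p _ → φ.+-homo p _ _ }
            ; ε-homo = 0 , λ p _ → φ.0#-homo p }
          ; *-homo = λ f g → 0 , λ p _ → φ.*-homo p _ _ }
        ; 1#-homo = 0 , λ p _ → φ.1#-homo p }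
      ; -‿homo = λ f → 0 , λ p _ → φ.-‿homo p _ }
    }

------------------------------------------------------------------------
-- The p-adic completion of ℤ[t], and the ring 𝒜̂

-- The exponent n starts at 0; that extra level is the zero ring and does not
-- affect the limits below.
ℤ/_^_[t] : ℙ → ℕ → CommutativeRing 0ℓ 0ℓ
ℤ/ p ^ n [t] = (ℤ/ (number p ℕ.^ n)) [t]

reduce : ∀ p n → RingHom (ℤ/ p ^ suc n [t]) (ℤ/ p ^ n [t])
reduce p n = mapCoefficients
  (ℤ/ (number p ℕ.^ suc n)) (ℤ/ (number p ℕ.^ n)) (reduceℤ (ℕ∣.n∣m*n (number p)))

module Completion (p : ℙ) = ProjectiveLimit (ℤ/ p ^_[t]) (reduce p)

ℤ[t]^ : ℙ → CommutativeRing 0ℓ 0ℓ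
ℤ[t]^ p = Completion.lim p

𝒜 : ℕ → CommutativeRing 0ℓ 0ℓ
𝒜 n = ModuloFinite.∏/⊕ (ℤ/_^ n [t])

module 𝒜̂-Limit = ProjectiveLimit 𝒜 (λ n → mapComponents (ℤ/_^ suc n [t]) (ℤ/_^ n [t]) (λ p → reduce p n))

𝒜̂ : CommutativeRing 0ℓ 0ℓ
𝒜̂ = 𝒜̂-Limit.lim

open 𝒜̂-Limit public using (HasSum)

∏ℤ[t]^ : Set
∏ℤ[t]^ = ∀ p → CommutativeRing.Carrier (ℤ[t]^ p)

π : ∏ℤ[t]^ → CommutativeRing.Carrier 𝒜̂
π x = record
  { at         = λ n p → let open Completion p in at (x p) n
  ; compatible = λ n → 0 , λ p _ → let open Completion p in compatible (x p) n
  }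

------------------------------------------------------------------------
-- Elements of ℤ[t]^ p

private
  signed : ∀ {d a m} → Bézout.Identity d a m → ℤ
  signed (Bézout.+- x y eq) = + x
  signed (Bézout.-+ x y eq) = ℤ.- (+ x)

  pos-+* : ∀ d y m → + (d ℕ.+ y ℕ.* m) ≡ + d ℤ.+ + y ℤ.* + m
  pos-+* d y m = ≡.cong (λ z → (+ d) ℤ.+ z) (ℤ.pos-* y m)

  signed-correct : ∀ {a m} (b : Bézout.Identity 1 a m) → signed b ℤ.* + a ≡ + 1 [mod m ]
  signed-correct {a} {m} (Bézout.+- x y eq) = congruent (divides (+ y) (begin
    + x ℤ.* + a ℤ.- + 1             ≡⟨ ≡.cong (λ z → z ℤ.- + 1) (ℤ.pos-* x a) ⟨
    + (x ℕ.* a) ℤ.- + 1             ≡⟨ ≡.cong (λ z → + z ℤ.- + 1) eq ⟨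
    + (1 ℕ.+ y ℕ.* m) ℤ.- + 1       ≡⟨ ≡.cong (λ z → z ℤ.- + 1) (pos-+* 1 y m) ⟩
    (+ 1 ℤ.+ + y ℤ.* + m) ℤ.- + 1   ≡⟨ lem (+ y ℤ.* + m) ⟩
    + y ℤ.* + m                     ∎))
    where
    open ≡.≡-Reasoning
    lem : ∀ z → (+ 1 ℤ.+ z) ℤ.- + 1 ≡ z
    lem = ℤSolver.solve-∀
  signed-correct {a} {m} (Bézout.-+ x y eq) = congruent (divides (ℤ.- (+ y)) (begin
    ℤ.- (+ x) ℤ.* + a ℤ.- + 1       ≡⟨ lem (+ x) (+ a) ⟩
    ℤ.- (+ 1 ℤ.+ + x ℤ.* + a)       ≡⟨ ≡.cong ℤ.-_ (pos-+* 1 x a) ⟨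
    ℤ.- (+ (1 ℕ.+ x ℕ.* a))         ≡⟨ ≡.cong (λ z → ℤ.- (+ z)) eq ⟩
    ℤ.- (+ (y ℕ.* m))               ≡⟨ ≡.cong ℤ.-_ (ℤ.pos-* y m) ⟩
    ℤ.- (+ y ℤ.* + m)               ≡⟨ ℤ.neg-distribˡ-* (+ y) (+ m) ⟩
    ℤ.- (+ y) ℤ.* + m               ∎))
    where
    open ≡.≡-Reasoning
    lem : ∀ x a → ℤ.- x ℤ.* a ℤ.- + 1 ≡ ℤ.- (+ 1 ℤ.+ x ℤ.* a)
    lem = ℤSolver.solve-∀

-- An inverse of a modulo m when a and m are coprime.
inverseMod : ℕ → ℕ → ℤ
inverseMod m a with Bézout.lemma a m
... | Bézout.result _ _ b = signed b

inverseMod-correct : ∀ {m a} → Coprime a m → inverseMod m a ℤ.* + a ≡ + 1 [mod m ]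
inverseMod-correct {m} {a} a⊥m with Bézout.lemma a m
... | Bézout.result _ g b with GCD.unique g (coprime⇒GCD≡1 a⊥m)
...   | ≡.refl = signed-correct b

private
  inverse-unique : ∀ {m a x y} →
    x ℤ.* a ≡ + 1 [mod m ] → y ℤ.* a ≡ + 1 [mod m ] → x ≡ y [mod m ]
  inverse-unique {m} {a} {x} {y} xa≡1 ya≡1 = begin
    x               ≈⟨ *-identityʳ x ⟨
    x ℤ.* + 1       ≈⟨ *-congˡ {x} ya≡1 ⟨
    x ℤ.* (y ℤ.* a) ≈⟨ ≡⇒mod (lem x y a) ⟩
    y ℤ.* (x ℤ.* a) ≈⟨ *-congˡ {y} xa≡1 ⟩
    y ℤ.* + 1       ≈⟨ *-identityʳ y ⟩
    y               ∎
    where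
    open CommutativeRing (ℤ/ m) using (setoid; *-identityʳ; *-congˡ)
    open SetoidReasoning setoid
    lem : ∀ x y a → x ℤ.* (y ℤ.* a) ≡ y ℤ.* (x ℤ.* a)
    lem = ℤSolver.solve-∀

coprime-^ : ∀ {p a} → Prime p → ¬ p ℕ∣.∣ a → ∀ n → Coprime a (p ℕ.^ n)
coprime-^ {p} {a} p-prime p∤a n {d} (d∣a , d∣pⁿ) = ℕ∣.∣1⇒≡1 (descend n d∣pⁿ)
  where
  d⊥p : Coprime d p
  d⊥p (e∣d , e∣p) with prime⇒irreducible p-prime e∣p
  ... | inj₁ e≡1    = e≡1
  ... | inj₂ ≡.refl = contradiction (ℕ∣.∣-trans e∣d d∣a) p∤a

  descend : ∀ n → d ℕ∣.∣ p ℕ.^ n → d ℕ∣.∣ 1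
  descend zero    h = h
  descend (suc n) h = descend n (coprime-divisor d⊥p h)

module _ (p : ℙ) where
  private
    module Z (n : ℕ) = CommutativeRing (ℤ/ (number p ℕ.^ n))
    module P (n : ℕ) = Polynomial (ℤ/ (number p ℕ.^ n))
    module Zt (n : ℕ) = CommutativeRing (ℤ/ p ^ n [t])
    open Completion p using (at)

  private
    inverse-compatible : ∀ {a} → ¬ number p ℕ∣.∣ a → ∀ n →
      inverseMod (number p ℕ.^ suc n) a ≡ inverseMod (number p ℕ.^ n) a [mod number p ℕ.^ n ]
    inverse-compatible {a} p∤a n = inverse-unique {a = + a}
      (mod-∣ (ℕ∣.n∣m*n (number p)) (inverseMod-correct (coprime-^ (primality p) p∤a (suc n))))
      (inverseMod-correct (coprime-^ (primality p) p∤a n))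

    recip : ∀ a → Dec (number p ℕ∣.∣ a) → CommutativeRing.Carrier (ℤ[t]^ p)
    recip a (yes _)   = CommutativeRing.0# (ℤ[t]^ p)
    recip a (no  p∤a) = record
      { at         = λ n → P.constant n (inverseMod (number p ℕ.^ n) a)
      ; compatible = λ n → P.∷-cong n (inverse-compatible {a} p∤a n) (Zt.refl n)
      }

    recip-correct : ∀ {a} (p∣a? : Dec (number p ℕ∣.∣ a)) → ¬ number p ℕ∣.∣ a → ∀ n →
      P._≈ₚ_ n (P._*ₚ_ n (at (recip a p∣a?) n) (P.constant n (+ a))) (P.constant n (+ 1))
    recip-correct     (yes p∣a) p∤a n = contradiction p∣a p∤a
    recip-correct {a} (no  p∤a) _   n = P.∷-cong n
      (Z.trans n (Z.+-identityʳ n _) (inverseMod-correct (coprime-^ (primality p) p∤a n)))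
      (Zt.refl n)

  -- 1/a, with the junk value 0 if p divides a (which for a fixed a ≥ 1
  -- happens at finitely many p only).
  1/_ : ℕ → CommutativeRing.Carrier (ℤ[t]^ p)
  1/ a = recip a (number p ℕ∣.∣? a)

  1/-correct : ∀ {a} → ¬ number p ℕ∣.∣ a → ∀ n →
    P._≈ₚ_ n (P._*ₚ_ n (at (1/ a) n) (P.constant n (+ a))) (P.constant n (+ 1))
  1/-correct {a} = recip-correct (number p ℕ∣.∣? a)

  𝑡 : CommutativeRing.Carrier (ℤ[t]^ p)
  𝑡 = record { at = P.indeterminate ; compatible = λ n → Zt.refl n }

------------------------------------------------------------------------
-- Star sums

module StarSum (R : CommutativeRing c ℓ) (recip : ℕ → CommutativeRing.Carrier R) where
  open CommutativeRing R
  open MonoidSum +-monoid using (sum)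

  ∑[1≤n≤_] : ℕ → (ℕ → Carrier) → Carrier
  ∑[1≤n≤ N ] f = sum {N} (λ j → f (suc (toℕ j)))

  -- ∑ g(n_m) / (n₁^k₁ ⋯ n_m^k_m) over N ≥ n₁ ≥ ⋯ ≥ n_m ≥ 1.
  starSum : (ℕ → Carrier) → ℕ → Index → Carrier
  starSum g N (k ∷ ks) = go N k ks
    where
    go : ℕ → ℕ⁺ → List ℕ⁺ → Carrier
    go N k []       = ∑[1≤n≤ N ] λ n → recip (n ℕ.^ value k) * g n
    go N k (l ∷ ls) = ∑[1≤n≤ N ] λ n → recip (n ℕ.^ value k) * go n l ls

-- In the next two definitions every denominator n ≤ p − 1 is prime to p, so
-- the junk value of 1/_ does not occur.  £★ k x is the star-multiple polylogarithm of index k at the argument x, a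
-- family of elements substituted for the indeterminate in each p-component.
£★ : Index → ∏ℤ[t]^ → CommutativeRing.Carrier 𝒜̂
£★ k x = π λ p →
  let open CommutativeRing (ℤ[t]^ p)
      open SemiringExp semiring using (_^_)
  in StarSum.starSum (ℤ[t]^ p) (1/_ p) (λ n → x p ^ n) (number p ∸ 1) k

ζ★ : Index → CommutativeRing.Carrier 𝒜̂
ζ★ k = π λ p →
  let open CommutativeRing (ℤ[t]^ p)
  in StarSum.starSum (ℤ[t]^ p) (1/_ p) (λ _ → 1#) (number p ∸ 1) k

1-𝑡 : ∏ℤ[t]^
1-𝑡 p = let open CommutativeRing (ℤ[t]^ p) in 1# - 𝑡 p

𝐩 : CommutativeRing.Carrier 𝒜̂
𝐩 = π λ p →
  let open CommutativeRing (ℤ[t]^ p)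
      open SemiringMult semiring using () renaming (_×_ to _⋅_)
  in number p ⋅ 1#

½ : CommutativeRing.Carrier 𝒜̂
½ = π (λ p → 1/_ p 2)

-- Let N = p − 1, let T be the binomial transform (TF)(n) = ∑ (−1)ʲ C(n,j) F(j), and let D and S be division
-- by n + 1 and partial summation. Since T is an involution with T D = D S T, conjugation by T exchanges the
-- operators D and D S, which are the letters 0 and 1 of the word of an index. Writing y = 1 − x, T also
-- sends D(1 − xⁿ⁺¹) to D(yⁿ⁺¹). On the other hand, summing over the number of leading 1's weighs the
-- outermost summation variable n by ∏_{n ≤ j < p} (1 − p/j)⁻¹ = (−1)ⁿ⁻¹ C(p−1, n−1), so each side of the
-- theorem is a value of A F = ∑_{j < N} (−1)ʲ C(N,j) F(j). As N is even, (TF)(N) = A F + F(N), and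
-- T² = 1 turns into A(TF) = − A F, without ever dividing by p.

module Submission where

open import Defs
open import Algebra.Bundles using (CommutativeRing)
import Algebra.Properties.Ring as RingProperties
import Algebra.Properties.Semiring.Exp as SemiringExp
import Algebra.Properties.Semiring.Mult as SemiringMult
import Algebra.Properties.Semiring.Mult.TCOptimised as SemiringMult′
import Algebra.Properties.Semiring.Sum as SemiringSum
import Algebra.Solver.Ring
open import Algebra.Solver.Ring.AlmostCommutativeRing using (fromCommutativeRing; _-Raw-AlmostCommutative⟶_)
open import Data.Fin.Base as Fin using (Fin; toℕ)
open import Data.Integer.Base as ℤ using (ℤ; +_; -[1+_])
import Data.Integer.Divisibility.Signed as ℤ∣
import Data.Integer.Properties as ℤ
open import Data.List.Base using ([]; _∷_)
open import Data.List.NonEmpty.Base using (_∷_)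
open import Data.Maybe.Base as Maybe using (Maybe)
open import Data.Nat.Base as ℕ using (ℕ; zero; suc; z≤n; s≤s; _≤_; _<_; _∸_)
open import Data.Nat.Divisibility using (_∣_; divides; ∣⇒≤; ∣1⇒≡1)
open import Data.Nat.Primality using (Prime; ¬prime[1]; euclidsLemma; prime⇒irreducible)
import Data.Nat.Properties as ℕ
open import Data.Product using (Σ; _×_; ∃-syntax; _,_)
open import Data.Sum.Base using (_⊎_; inj₁; inj₂)
open import Function.Base using (_∘_)
open import Level using (0ℓ; _⊔_)
open import Relation.Binary.PropositionalEquality.Core as ≡ using (_≡_)
import Relation.Binary.Reasoning.Setoid as SetoidReasoning
open import Relation.Nullary.Decidable.Core using (dec⇒maybe)
open import Relation.Nullary.Negation using (¬_; contradiction)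

-- A ring solver with integer coefficients

module IntegerCoefficients {c ℓ} (R : CommutativeRing c ℓ) where
  open CommutativeRing R hiding (zero)
  open RingProperties ring
  open SemiringMult′ semiring using (×-homo-+; ×1-homo-*; 1+×) renaming (_×_ to _⋅_)
  open SetoidReasoning setoid

  -- With the optimised multiple, `con (+ 1)` evaluates to `1#` itself, so solver equations match
  -- literal occurrences of `1#`.
  ⟦_⟧ℤ : ℤ → Carrier
  ⟦ + n      ⟧ℤ = n ⋅ 1#
  ⟦ -[1+ n ] ⟧ℤ = - (suc n ⋅ 1#)

  ⟦⟧-neg : ∀ i → ⟦ ℤ.- i ⟧ℤ ≈ - ⟦ i ⟧ℤ
  ⟦⟧-neg (+ zero)  = sym -0#≈0#
  ⟦⟧-neg (+ suc n) = refl
  ⟦⟧-neg -[1+ n ]  = sym (-‿involutive _)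

  ⟦⟧-⊖ : ∀ m n → ⟦ m ℤ.⊖ n ⟧ℤ ≈ m ⋅ 1# - n ⋅ 1#
  ⟦⟧-⊖ m       zero    = sym (trans (+-congˡ -0#≈0#) (+-identityʳ _))
  ⟦⟧-⊖ zero    (suc n) = sym (+-identityˡ _)
  ⟦⟧-⊖ (suc m) (suc n) = begin
    ⟦ suc m ℤ.⊖ suc n ⟧ℤ                 ≡⟨ ≡.cong ⟦_⟧ℤ (ℤ.[1+m]⊖[1+n]≡m⊖n m n) ⟩
    ⟦ m ℤ.⊖ n ⟧ℤ                         ≈⟨ ⟦⟧-⊖ m n ⟩
    m ⋅ 1# - n ⋅ 1#                      ≈⟨ +-congʳ (xyx⁻¹≈y 1# (m ⋅ 1#)) ⟨
    (1# + m ⋅ 1# - 1#) - n ⋅ 1#          ≈⟨ +-assoc _ _ _ ⟩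
    (1# + m ⋅ 1#) + (- 1# - n ⋅ 1#)      ≈⟨ +-congˡ (-‿+-comm 1# (n ⋅ 1#)) ⟩
    (1# + m ⋅ 1#) - (1# + n ⋅ 1#)        ≈⟨ +-cong (1+× m 1#) (-‿cong (1+× n 1#)) ⟨
    suc m ⋅ 1# - suc n ⋅ 1#              ∎

  ⟦⟧-+ : ∀ i j → ⟦ i ℤ.+ j ⟧ℤ ≈ ⟦ i ⟧ℤ + ⟦ j ⟧ℤ
  ⟦⟧-+ (+ m)    (+ n)    = ×-homo-+ 1# m n
  ⟦⟧-+ (+ m)    -[1+ n ] = ⟦⟧-⊖ m (suc n)
  ⟦⟧-+ -[1+ m ] (+ n)    = trans (⟦⟧-⊖ n (suc m)) (+-comm _ _)
  ⟦⟧-+ -[1+ m ] -[1+ n ] = begin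
    - (suc (suc (m ℕ.+ n)) ⋅ 1#)    ≡⟨ ≡.cong (λ k → - (k ⋅ 1#)) (≡.cong suc (ℕ.+-suc m n)) ⟨
    - ((suc m ℕ.+ suc n) ⋅ 1#)      ≈⟨ -‿cong (×-homo-+ 1# (suc m) (suc n)) ⟩
    - (suc m ⋅ 1# + suc n ⋅ 1#)     ≈⟨ -‿+-comm _ _ ⟨
    - (suc m ⋅ 1#) - suc n ⋅ 1#     ∎

  ⟦⟧-+* : ∀ m j → ⟦ + m ℤ.* j ⟧ℤ ≈ m ⋅ 1# * ⟦ j ⟧ℤ
  ⟦⟧-+* m (+ n) = trans (reflexive (≡.cong ⟦_⟧ℤ (≡.sym (ℤ.pos-* m n)))) (×1-homo-* m n)
  ⟦⟧-+* m -[1+ n ] = begin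
    ⟦ + m ℤ.* -[1+ n ] ⟧ℤ         ≡⟨ ≡.cong ⟦_⟧ℤ (ℤ.neg-distribʳ-* (+ m) (+ suc n)) ⟨
    ⟦ ℤ.- (+ m ℤ.* + suc n) ⟧ℤ    ≈⟨ ⟦⟧-neg (+ m ℤ.* + suc n) ⟩
    - ⟦ + m ℤ.* + suc n ⟧ℤ        ≈⟨ -‿cong (⟦⟧-+* m (+ suc n)) ⟩
    - (m ⋅ 1# * suc n ⋅ 1#)       ≈⟨ -‿distribʳ-* _ _ ⟩
    m ⋅ 1# * - (suc n ⋅ 1#)       ∎
  ⟦⟧-* : ∀ i j → ⟦ i ℤ.* j ⟧ℤ ≈ ⟦ i ⟧ℤ * ⟦ j ⟧ℤ
  ⟦⟧-* (+ m)    j = ⟦⟧-+* m j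
  ⟦⟧-* -[1+ m ] j = begin
    ⟦ -[1+ m ] ℤ.* j ⟧ℤ           ≡⟨ ≡.cong ⟦_⟧ℤ (ℤ.neg-distribˡ-* (+ suc m) j) ⟨
    ⟦ ℤ.- (+ suc m ℤ.* j) ⟧ℤ      ≈⟨ ⟦⟧-neg (+ suc m ℤ.* j) ⟩
    - ⟦ + suc m ℤ.* j ⟧ℤ          ≈⟨ -‿cong (⟦⟧-+* (suc m) j) ⟩
    - (suc m ⋅ 1# * ⟦ j ⟧ℤ)       ≈⟨ -‿distribˡ-* _ _ ⟩
    - (suc m ⋅ 1#) * ⟦ j ⟧ℤ       ∎

  ℤ⟶R : ℤ.+-*-rawRing -Raw-AlmostCommutative⟶ fromCommutativeRing R
  ℤ⟶R = record
    { ⟦_⟧ = ⟦_⟧ℤ ; +-homo = ⟦⟧-+ ; *-homo = ⟦⟧-* ; -‿homo = ⟦⟧-neg ; 0-homo = refl ; 1-homo = refl }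

  -- Equality in `R` need not be decidable; deciding it on integers is enough to cancel
  -- coefficients.
  coefficient≟ : ∀ i j → Maybe (⟦ i ⟧ℤ ≈ ⟦ j ⟧ℤ)
  coefficient≟ i j = Maybe.map (λ i≡j → reflexive (≡.cong ⟦_⟧ℤ i≡j)) (dec⇒maybe (i ℤ.≟ j))

  open Algebra.Solver.Ring ℤ.+-*-rawRing (fromCommutativeRing R) ℤ⟶R coefficient≟
    public using (solve; _:+_; _:*_; _:-_; :-_; _:=_; con)

-- Sums over initial segments

module InitialSums {c ℓ} (R : CommutativeRing c ℓ) where
  open CommutativeRing R hiding (zero)
  open SemiringSum semiring using (sum; *-distribˡ-sum)
  open IntegerCoefficients R
  open SetoidReasoning setoid

  ∑< : ℕ → (ℕ → Carrier) → Carrier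
  ∑< n F = sum {n} (λ i → F (toℕ i))

  -- `sum` unfolds at its first summand, while the telescoping arguments below split off the last.
  ∑<-suc : ∀ n F → ∑< (suc n) F ≈ ∑< n F + F n
  ∑<-suc zero    F = +-comm _ _
  ∑<-suc (suc n) F = begin
    F 0 + ∑< (suc n) (F ∘ suc)            ≈⟨ +-congˡ (∑<-suc n (F ∘ suc)) ⟩
    F 0 + (∑< n (F ∘ suc) + F (suc n))    ≈⟨ +-assoc _ _ _ ⟨
    ∑< (suc n) F + F (suc n)              ∎

  ∑<-cong : ∀ n {F G} → (∀ {i} → i < n → F i ≈ G i) → ∑< n F ≈ ∑< n G
  ∑<-cong zero    F≈G = refl
  ∑<-cong (suc n) F≈G = +-cong (F≈G (s≤s z≤n)) (∑<-cong n (λ i<n → F≈G (s≤s i<n)))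

  ∑<-zero : ∀ n {F} → (∀ i → F i ≈ 0#) → ∑< n F ≈ 0#
  ∑<-zero zero    F≈0 = refl
  ∑<-zero (suc n) F≈0 = trans (+-cong (F≈0 0) (∑<-zero n (F≈0 ∘ suc))) (+-identityʳ 0#)

  ∑<-minus : ∀ n F G → ∑< n (λ i → F i - G i) ≈ ∑< n F - ∑< n G
  ∑<-minus zero    F G = sym (-‿inverseʳ 0#)
  ∑<-minus (suc n) F G = trans (+-congˡ (∑<-minus n (F ∘ suc) (G ∘ suc)))
    (solve 4 (λ a b c d → (a :- b) :+ (c :- d) := (a :+ c) :- (b :+ d)) refl _ _ _ _)

  ∑<-*ˡ : ∀ n a F → a * ∑< n F ≈ ∑< n (λ i → a * F i)
  ∑<-*ˡ n a F = *-distribˡ-sum {n} a (λ i → F (toℕ i))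

-- The binomial transform

module BinomialTransform {c ℓ} (R : CommutativeRing c ℓ) where
  open CommutativeRing R hiding (zero)
  open SemiringMult semiring using () renaming (_×_ to _⋅_)
  open SemiringExp semiring using (_^_)
  open IntegerCoefficients R
  open InitialSums R
  open SetoidReasoning setoid

  ι : ℕ → Carrier
  ι n = n ⋅ 1#

  Sequence : Set c
  Sequence = ℕ → Carrier

  infixl 6 _⊝_

  _⊝_ : Sequence → Sequence → Sequence
  (F ⊝ G) n = F n - G n

  infixl 7 _⊛_

  _⊛_ : Sequence → Sequence → Sequence
  (F ⊛ G) n = F n * G n

  ∇ : Sequence → Sequence
  ∇ F = F ⊝ F ∘ suc

  -- T F n = Σ_j (−1)^j C(n,j) F j; see T≈∑.
  T : Sequence → Sequence
  T F zero    = F zero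
  T F (suc n) = T (∇ F) n

  T-cong : ∀ n {F G} → (∀ {i} → i ≤ n → F i ≈ G i) → T F n ≈ T G n
  T-cong zero    F≈G = F≈G z≤n
  T-cong (suc n) F≈G = T-cong n λ i≤n →
    +-cong (F≈G (ℕ.m≤n⇒m≤1+n i≤n)) (-‿cong (F≈G (s≤s i≤n)))

  T-minus : ∀ n F G → T (F ⊝ G) n ≈ T F n - T G n
  T-minus zero    F G = refl
  T-minus (suc n) F G = trans
    (T-cong n λ {i} _ → solve 4 (λ a b c d → (a :- b) :- (c :- d) := (a :- c) :- (b :- d)) refl
      (F i) (G i) (F (suc i)) (G (suc i)))
    (T-minus n (∇ F) (∇ G))

  T-suc : ∀ n F → T F (suc n) ≈ T F n - T (F ∘ suc) n
  T-suc n F = T-minus n F (F ∘ suc)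

  -- By definition `T` carries `∇` to the shift; linearity gives the converse exchange. Together
  -- they make `T` an involution.
  ∇-T : ∀ n F → ∇ (T F) n ≈ T (F ∘ suc) n
  ∇-T n F = trans (+-congˡ (-‿cong (T-suc n F)))
    (solve 2 (λ a b → a :- (a :- b) := b) refl _ _)

  T-involutive : ∀ n F → T (T F) n ≈ F n
  T-involutive zero    F = refl
  T-involutive (suc n) F = trans (T-cong n λ {i} _ → ∇-T i F) (T-involutive n (F ∘ suc))

  -- The binomial theorem for (1 - x)^n. Since `∇` multiplies a geometric sequence by y, the
  -- induction carries a scalar `a`.
  T-geometric : ∀ n a x y → x + y ≈ 1# → T (λ i → a * x ^ i) n ≈ a * y ^ n
  T-geometric zero    a x y x+y≈1 = refl
  T-geometric (suc n) a x y x+y≈1 = begin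
    T (∇ (λ i → a * x ^ i)) n     ≈⟨ T-cong n (λ {i} _ → step i) ⟩
    T (λ i → (a * y) * x ^ i) n   ≈⟨ T-geometric n (a * y) x y x+y≈1 ⟩
    (a * y) * y ^ n               ≈⟨ *-assoc _ _ _ ⟩
    a * (y * y ^ n)               ∎
    where
    step : ∀ i → a * x ^ i - a * (x * x ^ i) ≈ (a * y) * x ^ i
    step i = begin
      a * x ^ i - a * (x * x ^ i)               ≈⟨ +-congʳ (*-congˡ (*-identityˡ _)) ⟨
      a * (1# * x ^ i) - a * (x * x ^ i)        ≈⟨ +-congʳ (*-congˡ (*-congʳ x+y≈1)) ⟨
      a * ((x + y) * x ^ i) - a * (x * x ^ i)
        ≈⟨ solve 4 (λ a x y z → a :* ((x :+ y) :* z) :- a :* (x :* z) := (a :* y) :* z) refl a x y (x ^ i) ⟩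
      (a * y) * x ^ i                           ∎

  X : Sequence → Sequence
  X F n = ι (suc n) * F n

  -- The right side is the increment of `X (T F)`, so that partial sums telescope. The induction
  -- rests on `∇ (X F)` being `X (∇ F) ⊝ F ∘ suc`.
  T-X : ∀ n F → T (X F) (suc n) ≈ ι (2 ℕ.+ n) * T F (suc n) - ι (suc n) * T F n
  -- `ι 1` and `ι 2` unfold to `1# + 0#` and `1# + (1# + 0#)`, which the solver terms spell out.
  T-X zero    F = solve 2 (λ a b → (con (+ 1) :+ con (+ 0)) :* a :- (con (+ 1) :+ (con (+ 1) :+ con (+ 0))) :* b
      := (con (+ 1) :+ (con (+ 1) :+ con (+ 0))) :* (a :- b) :- (con (+ 1) :+ con (+ 0)) :* a) refl (F 0) (F 1)
  T-X (suc n) F = begin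
    T (∇ (X F)) (suc n)
      ≈⟨ T-cong (suc n) (λ {i} _ → solve 3 (λ k a b → k :* a :- (con (+ 1) :+ k) :* b := k :* (a :- b) :- b)
           refl (ι (suc i)) (F i) (F (suc i))) ⟩
    T (X (∇ F) ⊝ F ∘ suc) (suc n)
      ≈⟨ T-minus (suc n) (X (∇ F)) (F ∘ suc) ⟩
    T (X (∇ F)) (suc n) - T (F ∘ suc) (suc n)
      ≈⟨ +-cong (T-X n (∇ F)) (-‿cong (sym (∇-T (suc n) F))) ⟩
    (ι (2 ℕ.+ n) * T F (2 ℕ.+ n) - ι (suc n) * T F (suc n)) - (T F (suc n) - T F (2 ℕ.+ n))
      ≈⟨ solve 3 (λ k a b → ((con (+ 1) :+ k) :* a :- k :* b) :- (b :- a)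
           := (con (+ 1) :+ (con (+ 1) :+ k)) :* a :- (con (+ 1) :+ k) :* b) refl (ι (suc n)) _ _ ⟩
    ι (3 ℕ.+ n) * T F (2 ℕ.+ n) - ι (2 ℕ.+ n) * T F (suc n) ∎

  S : Sequence → Sequence
  S F n = ∑< (suc n) F

  -- Telescopes `T-X`. Since `X` undoes division by n + 1, this is T D = D S T in a form free of
  -- reciprocals.
  S-T-X : ∀ n F → S (T (X F)) n ≈ ι (suc n) * T F n
  S-T-X zero    F = +-identityʳ _
  S-T-X (suc n) F = begin
    S (T (X F)) (suc n)                 ≈⟨ ∑<-suc (suc n) (T (X F)) ⟩
    S (T (X F)) n + T (X F) (suc n)     ≈⟨ +-cong (S-T-X n F) (T-X n F) ⟩
    ι (suc n) * T F n + (ι (2 ℕ.+ n) * T F (suc n) - ι (suc n) * T F n)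
      ≈⟨ solve 2 (λ a b → a :+ (b :- a) := b) refl _ _ ⟩
    ι (2 ℕ.+ n) * T F (suc n)           ∎

  Reciprocals : ℕ → Sequence → Set ℓ
  Reciprocals N r = ∀ {m} → m < N → r m * ι (suc m) ≈ 1#

  -- A star sum inverts each power n^k as a whole, so multiplicativity of `recip` has to be assumed
  -- separately.
  PowersOfReciprocals : ℕ → (ℕ → Carrier) → Set ℓ
  PowersOfReciprocals N recip =
    ∀ {m} v → m < N → recip (suc m ℕ.^ suc v) ≈ recip (suc m) * recip (suc m ℕ.^ v)

  S-minus : ∀ n F G → S (F ⊝ G) n ≈ S F n - S G n
  S-minus n = ∑<-minus (suc n)

  -- Signed binomial coefficients and the truncated alternating sum

  -- b n j = (−1)^j C(n,j)
  b : ℕ → ℕ → Carrier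
  b _       zero    = 1#
  b zero    (suc j) = 0#
  b (suc n) (suc j) = b n (suc j) - b n j

  b-above : ∀ n d → b n (suc (n ℕ.+ d)) ≈ 0#
  b-above zero    d = refl
  b-above (suc n) d = begin
    b n (suc (suc (n ℕ.+ d))) - b n (suc (n ℕ.+ d))
      ≈⟨ +-cong (trans (reflexive (≡.cong (b n ∘ suc) (≡.sym (ℕ.+-suc n d)))) (b-above n (suc d)))
                (-‿cong (b-above n d)) ⟩
    0# - 0#  ≈⟨ -‿inverseʳ 0# ⟩
    0#       ∎

  b-above′ : ∀ n → b n (suc n) ≈ 0#
  b-above′ n = trans (reflexive (≡.cong (b n ∘ suc) (≡.sym (ℕ.+-identityʳ n)))) (b-above n 0)

  -- The diagonal entry changes sign with each row, so the induction advances two rows at a time.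
  b-diagonal : ∀ m → b (m ℕ.* 2) (m ℕ.* 2) ≈ 1#
  b-diagonal zero    = refl
  b-diagonal (suc m) = begin
    (b n (2 ℕ.+ n) - b n (suc n)) - (b n (suc n) - b n n)
      ≈⟨ +-cong (+-cong bₙ₊₂ (-‿cong (b-above′ n))) (-‿cong (+-cong (b-above′ n) (-‿cong (b-diagonal m)))) ⟩
    (0# - 0#) - (0# - 1#)
      ≈⟨ solve 0 ((con (+ 0) :- con (+ 0)) :- (con (+ 0) :- con (+ 1)) := con (+ 1)) refl ⟩
    1# ∎
    where
    n = m ℕ.* 2
    bₙ₊₂ : b n (2 ℕ.+ n) ≈ 0#
    bₙ₊₂ = trans (reflexive (≡.cong (b n ∘ suc) (≡.sym (ℕ.+-comm n 1)))) (b-above n 1)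

  b-even : ∀ {n} → ∃[ m ] n ≡ m ℕ.* 2 → b n n ≈ 1#
  b-even (m , ≡.refl) = b-diagonal m

  -- The absorption identity (j + 1) C(n,j+1) = (n - j) C(n,j) with signs; it yields the ratio of
  -- neighbouring coefficients in `b-suc`.
  b-absorb : ∀ n j → ι (suc j) * b n (suc j) ≈ (ι j - ι n) * b n j
  b-absorb zero    zero    = solve 0
    ((con (+ 1) :+ con (+ 0)) :* con (+ 0) := (con (+ 0) :- con (+ 0)) :* con (+ 1)) refl
  b-absorb zero    (suc j) = trans (zeroʳ _) (sym (zeroʳ _))
  b-absorb (suc n) zero    = begin
    (1# + 0#) * (b n 1 - 1#)           ≈⟨ distribˡ _ _ _ ⟩
    (1# + 0#) * b n 1 + (1# + 0#) * - 1#  ≈⟨ +-congʳ (b-absorb n zero) ⟩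
    (0# - ι n) * 1# + (1# + 0#) * - 1#
      ≈⟨ solve 1 (λ k → (con (+ 0) :- k) :* con (+ 1) :+ (con (+ 1) :+ con (+ 0)) :* (:- con (+ 1))
           := (con (+ 0) :- (con (+ 1) :+ k)) :* con (+ 1)) refl (ι n) ⟩
    (0# - ι (suc n)) * 1#              ∎
  b-absorb (suc n) (suc j) = begin
    ι (2 ℕ.+ j) * (b n (2 ℕ.+ j) - b n (suc j))
      ≈⟨ distribˡ _ _ _ ⟩
    ι (2 ℕ.+ j) * b n (2 ℕ.+ j) + ι (2 ℕ.+ j) * - b n (suc j)
      ≈⟨ +-congʳ (b-absorb n (suc j)) ⟩
    (ι (suc j) - ι n) * b n (suc j) + ι (2 ℕ.+ j) * - b n (suc j)
      ≈⟨ solve 3 (λ k l u → ((con (+ 1) :+ k) :- l) :* u :+ (con (+ 1) :+ (con (+ 1) :+ k)) :* (:- u)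
           := (k :- l) :* u :- (con (+ 1) :+ k) :* u) refl (ι j) (ι n) (b n (suc j)) ⟩
    (ι j - ι n) * b n (suc j) - ι (suc j) * b n (suc j)
      ≈⟨ +-congˡ (-‿cong (b-absorb n j)) ⟩
    (ι j - ι n) * b n (suc j) - (ι j - ι n) * b n j
      ≈⟨ solve 4 (λ k l u v → (k :- l) :* u :- (k :- l) :* v
           := ((con (+ 1) :+ k) :- (con (+ 1) :+ l)) :* (u :- v)) refl (ι j) (ι n) (b n (suc j)) (b n j) ⟩
    (ι (suc j) - ι (suc n)) * (b n (suc j) - b n j) ∎

  -- Summation by parts moves the difference from `F` to the coefficients, where Pascal's rule
  -- produces the next row. The boundary term at n + 1 lies above the diagonal and vanishes.
  T≈∑ : ∀ n F → T F n ≈ ∑< (suc n) (b n ⊛ F)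
  T≈∑ zero    F = sym (trans (+-identityʳ _) (*-identityˡ _))
  T≈∑ (suc n) F = begin
    T (∇ F) n                                          ≈⟨ T≈∑ n (∇ F) ⟩
    ∑< (suc n) (b n ⊛ ∇ F)                   ≈⟨ +-identityʳ _ ⟨
    ∑< (suc n) (b n ⊛ ∇ F) + 0#              ≈⟨ +-congˡ (trans (*-congʳ (b-above′ n)) (zeroˡ _)) ⟨
    ∑< (suc n) (b n ⊛ ∇ F) + b n (suc n) * F (suc n) ≈⟨ by-parts (suc n) ⟨
    ∑< (2 ℕ.+ n) (b (suc n) ⊛ F)             ∎
    where
    by-parts : ∀ m → ∑< (suc m) (b (suc n) ⊛ F) ≈ ∑< m (b n ⊛ ∇ F) + b n m * F m
    by-parts zero    = +-comm _ _
    by-parts (suc m) = begin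
      ∑< (2 ℕ.+ m) (b (suc n) ⊛ F)
        ≈⟨ ∑<-suc (suc m) (b (suc n) ⊛ F) ⟩
      ∑< (suc m) (b (suc n) ⊛ F) + (b n (suc m) - b n m) * F (suc m)
        ≈⟨ +-congʳ (by-parts m) ⟩
      (∑< m (b n ⊛ ∇ F) + b n m * F m) + (b n (suc m) - b n m) * F (suc m)
        ≈⟨ solve 5 (λ s u v f g → (s :+ u :* f) :+ (v :- u) :* g := (s :+ u :* (f :- g)) :+ v :* g) refl
             _ (b n m) (b n (suc m)) (F m) (F (suc m)) ⟩
      (∑< m (b n ⊛ ∇ F) + b n m * ∇ F m) + b n (suc m) * F (suc m)
        ≈⟨ +-congʳ (∑<-suc m (b n ⊛ ∇ F)) ⟨
      ∑< (suc m) (b n ⊛ ∇ F) + b n (suc m) * F (suc m) ∎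

  -- The sum for `T F N` without its top term, so that only positions below `N` are read: at
  -- position `N` a division would be by N + 1 = p.
  A : ℕ → Sequence → Carrier
  A N F = ∑< N (b N ⊛ F)

  A-cong : ∀ N {F G} → (∀ {i} → i < N → F i ≈ G i) → A N F ≈ A N G
  A-cong N {F} {G} F≈G = ∑<-cong N {b N ⊛ F} {b N ⊛ G} λ i<N → *-congˡ (F≈G i<N)

  A-minus : ∀ N F G → A N (F ⊝ G) ≈ A N F - A N G
  A-minus N F G = trans
    (∑<-cong N {b N ⊛ (F ⊝ G)} {b N ⊛ F ⊝ b N ⊛ G} λ {i} _ → solve 3 (λ u f g → u :* (f :- g) := u :* f :- u :* g) refl (b N i) (F i) (G i))
    (∑<-minus N (b N ⊛ F) (b N ⊛ G))

  T≈A : ∀ N F → b N N ≈ 1# → T F N ≈ A N F + F N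
  T≈A N F bNN≈1 = begin
    T F N                   ≈⟨ T≈∑ N F ⟩
    ∑< (suc N) (b N ⊛ F) ≈⟨ ∑<-suc N (b N ⊛ F) ⟩
    A N F + b N N * F N     ≈⟨ +-congˡ (trans (*-congʳ bNN≈1) (*-identityˡ _)) ⟩
    A N F + F N             ∎

  -- Applying `T≈A` twice writes `T (T F) N` as `A N (T F) + A N F + F N`. It equals `F N` by
  -- involutivity, and `F N` cancels whatever its value.
  A-T : ∀ N F → b N N ≈ 1# → A N (T F) ≈ - A N F
  A-T N F bNN≈1 = begin
    A N (T F)                                      ≈⟨ solve 3 (λ a b c → a := (a :+ (b :+ c)) :- c :- b) refl _ _ _ ⟩
    (A N (T F) + (A N F + F N)) - F N - A N F      ≈⟨ +-congʳ (+-congʳ (+-congˡ (T≈A N F bNN≈1))) ⟨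
    (A N (T F) + T F N) - F N - A N F              ≈⟨ +-congʳ (+-congʳ (T≈A N (T F) bNN≈1)) ⟨
    T (T F) N - F N - A N F                        ≈⟨ +-congʳ (+-congʳ (T-involutive N F)) ⟩
    F N - F N - A N F                              ≈⟨ solve 2 (λ a b → a :- a :- b := :- b) refl _ _ ⟩
    - A N F                                        ∎

-- Division and summation operators under the transform

module HarmonicOperators {c ℓ} (R : CommutativeRing c ℓ)
  (N : ℕ) (r : ℕ → CommutativeRing.Carrier R) (r-inverse : BinomialTransform.Reciprocals R N r)
  where
  open CommutativeRing R hiding (zero)
  open BinomialTransform R
  open SemiringExp semiring using (_^_)
  open IntegerCoefficients R
  open InitialSums R
  open SetoidReasoning setoid

  D : Sequence → Sequence
  D F = r ⊛ F

  S-cong : ∀ n {F G} → (∀ {i} → i ≤ n → F i ≈ G i) → S F n ≈ S G n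
  S-cong n {F} {G} F≈G = ∑<-cong (suc n) {F} {G} λ { (s≤s i≤n) → F≈G i≤n }

  -- Insert `r m * ι (suc m)`, which is 1, and apply `S-T-X` to `D F`; below `N` the operator `X`
  -- cancels `D`.
  T-D : ∀ {m} F → m < N → T (D F) m ≈ D (S (T F)) m
  T-D {m} F m<N = begin
    T (D F) m                         ≈⟨ *-identityˡ _ ⟨
    1# * T (D F) m                    ≈⟨ *-congʳ (r-inverse m<N) ⟨
    (r m * ι (suc m)) * T (D F) m     ≈⟨ *-assoc _ _ _ ⟩
    r m * (ι (suc m) * T (D F) m)     ≈⟨ *-congˡ (S-T-X m (D F)) ⟨
    r m * S (T (X (D F))) m           ≈⟨ *-congˡ (S-cong m λ {j} j≤m → T-cong j λ i≤j →
                                           X-D (ℕ.≤-<-trans (ℕ.≤-trans i≤j j≤m) m<N)) ⟩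
    r m * S (T F) m                   ∎
    where
    X-D : ∀ {i} → i < N → X (D F) i ≈ F i
    X-D {i} i<N = begin
      ι (suc i) * (r i * F i)   ≈⟨ solve 3 (λ a b c → a :* (b :* c) := (b :* a) :* c) refl _ _ _ ⟩
      (r i * ι (suc i)) * F i   ≈⟨ *-congʳ (r-inverse i<N) ⟩
      1# * F i                  ≈⟨ *-identityˡ _ ⟩
      F i                       ∎

  -- `T-D` conjugated by the involution `T`.
  T-D-S : ∀ {m} F → m < N → T (D (S F)) m ≈ D (T F) m
  T-D-S {m} F m<N = begin
    T (D (S F)) m           ≈⟨ T-cong m (λ {i} _ → *-congˡ (S-cong i λ {j} _ → sym (T-involutive j F))) ⟩
    T (D (S (T (T F)))) m   ≈⟨ T-cong m (λ i≤m → sym (T-D (T F) (ℕ.≤-<-trans i≤m m<N))) ⟩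
    T (T (D (T F))) m       ≈⟨ T-involutive m (D (T F)) ⟩
    D (T F) m               ∎

  -- The word of an index is taken without its final 1; that letter is the innermost division,
  -- supplied by applying `W u` to `D F`.
  W : Word → Sequence → Sequence
  W []      F = F
  W (𝟎 ∷ u) F = D (W u F)
  W (𝟏 ∷ u) F = D (S (W u F))

  W-cong : ∀ u n {F G} → (∀ {i} → i ≤ n → F i ≈ G i) → W u F n ≈ W u G n
  W-cong []      n F≈G = F≈G ℕ.≤-refl
  W-cong (𝟎 ∷ u) n F≈G = *-congˡ (W-cong u n F≈G)
  W-cong (𝟏 ∷ u) n F≈G = *-congˡ (S-cong n λ {j} j≤n → W-cong u j λ i≤j → F≈G (ℕ.≤-trans i≤j j≤n))

  D-minus : ∀ n F G → D (F ⊝ G) n ≈ (D F ⊝ D G) n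
  D-minus n F G = solve 3 (λ a f g → a :* (f :- g) := a :* f :- a :* g) refl (r n) (F n) (G n)

  W-minus : ∀ u n F G → W u (F ⊝ G) n ≈ (W u F ⊝ W u G) n
  W-minus []      n F G = refl
  W-minus (𝟎 ∷ u) n F G = trans (*-congˡ (W-minus u n F G)) (D-minus n (W u F) (W u G))
  W-minus (𝟏 ∷ u) n F G = begin
    r n * S (W u (F ⊝ G)) n              ≈⟨ *-congˡ (S-cong n λ {j} _ → W-minus u j F G) ⟩
    r n * S (W u F ⊝ W u G) n            ≈⟨ *-congˡ (S-minus n (W u F) (W u G)) ⟩
    r n * (S (W u F) n - S (W u G) n)    ≈⟨ D-minus n (S (W u F)) (S (W u G)) ⟩
    (D (S (W u F)) ⊝ D (S (W u G))) n    ∎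

  -- `T-D` turns the letter 0 into 1 and `T-D-S` turns 1 into 0; this is how the Hoffman dual
  -- arises.
  T-W : ∀ u {m} F → m < N → T (W u F) m ≈ W (τ u) (T F) m
  T-W []      F m<N = refl
  T-W (𝟎 ∷ u) {m} F m<N = trans (T-D (W u F) m<N)
    (*-congˡ (S-cong m λ j≤m → T-W u F (ℕ.≤-<-trans j≤m m<N)))
  T-W (𝟏 ∷ u) F m<N = trans (T-D-S (W u F) m<N) (*-congˡ (T-W u F m<N))

  𝟙 : Sequence
  𝟙 _ = 1#

  -- Position n stands for the summation variable n + 1, hence the shifted exponent.
  pow : Carrier → Sequence
  pow x n = x ^ suc n

  -- By `T-D` it remains to sum `T (𝟙 ⊝ pow x)`. Its difference sequence being geometric,
  -- `T-geometric` gives the increments of `pow y`, and the initial value 1 - x = y leaves no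
  -- constant in the telescoping.
  T-D-pow : ∀ {m} x y → x + y ≈ 1# → m < N → T (D (𝟙 ⊝ pow x)) m ≈ D (pow y) m
  T-D-pow {m} x y x+y≈1 m<N = trans (T-D (𝟙 ⊝ pow x) m<N) (*-congˡ (telescope m))
    where
    1-x≈y : 1# - x ≈ y
    1-x≈y = trans (+-congʳ (sym x+y≈1)) (solve 2 (λ x y → (x :+ y) :- x := y) refl x y)

    difference : ∀ n → T (𝟙 ⊝ pow x) (suc n) ≈ pow y (suc n) - pow y n
    difference n = begin
      T (∇ (𝟙 ⊝ pow x)) n
        ≈⟨ T-cong n (λ {i} _ → step i) ⟩
      T (λ i → (- (x * y)) * x ^ i) n
        ≈⟨ T-geometric n (- (x * y)) x y x+y≈1 ⟩
      (- (x * y)) * y ^ n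
        ≈⟨ *-congʳ (-‿cong (*-congʳ x≈1-y)) ⟩
      (- ((1# - y) * y)) * y ^ n
        ≈⟨ solve 2 (λ y z → (:- ((con (+ 1) :- y) :* y)) :* z := y :* (y :* z) :- y :* z) refl y (y ^ n) ⟩
      pow y (suc n) - pow y n ∎
      where
      x≈1-y : x ≈ 1# - y
      x≈1-y = trans (solve 2 (λ x y → x := (x :+ y) :- y) refl x y) (+-congʳ x+y≈1)
      step : ∀ i → (1# - x * x ^ i) - (1# - x * (x * x ^ i)) ≈ (- (x * y)) * x ^ i
      step i = begin
        (1# - x * x ^ i) - (1# - x * (x * x ^ i))
          ≈⟨ solve 2 (λ x z → (con (+ 1) :- x :* z) :- (con (+ 1) :- x :* (x :* z)) := (:- (x :* (con (+ 1) :- x))) :* z)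
               refl x (x ^ i) ⟩
        (- (x * (1# - x))) * x ^ i   ≈⟨ *-congʳ (-‿cong (*-congˡ 1-x≈y)) ⟩
        (- (x * y)) * x ^ i          ∎

    telescope : ∀ n → S (T (𝟙 ⊝ pow x)) n ≈ pow y n
    telescope zero = begin
      (1# - x * 1#) + 0#   ≈⟨ solve 1 (λ x → (con (+ 1) :- x :* con (+ 1)) :+ con (+ 0) := (con (+ 1) :- x)) refl x ⟩
      1# - x               ≈⟨ 1-x≈y ⟩
      y                    ≈⟨ *-identityʳ y ⟨
      y * 1#               ∎
    telescope (suc n) = begin
      S (T (𝟙 ⊝ pow x)) (suc n)                       ≈⟨ ∑<-suc (suc n) (T (𝟙 ⊝ pow x)) ⟩
      S (T (𝟙 ⊝ pow x)) n + T (𝟙 ⊝ pow x) (suc n)     ≈⟨ +-cong (telescope n) (difference n) ⟩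
      pow y n + (pow y (suc n) - pow y n)             ≈⟨ solve 2 (λ a b → a :+ (b :- a) := b) refl _ _ ⟩
      pow y (suc n)                                   ∎

  -- Reflection and duality of the alternating sum

  module Duality (bNN≈1 : b N N ≈ 1#) where

    -- The value of the whole series over leading 1's, by `∑-starSum`; `F` is the numerator: `pow x`
    -- for polylogarithms, `𝟙` for zeta values.
    L : Word → Sequence → Carrier
    L u F = A N (W u (D F))

    L-minus : ∀ u F G → L u (F ⊝ G) ≈ L u F - L u G
    L-minus u F G = begin
      A N (W u (D (F ⊝ G)))                  ≈⟨ A-cong N (λ {i} _ → trans (W-cong u i (λ {j} _ → D-minus j F G)) (W-minus u i (D F) (D G))) ⟩
      A N (W u (D F) ⊝ W u (D G))            ≈⟨ A-minus N (W u (D F)) (W u (D G)) ⟩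
      L u F - L u G                          ∎

    L-cong : ∀ u {F G} → (∀ n → F n ≈ G n) → L u F ≈ L u G
    L-cong u F≈G = A-cong N λ {i} _ → W-cong u i λ {j} _ → *-congˡ (F≈G j)

    -- Split `pow x` as `𝟙` minus `𝟙 ⊝ pow x`. On the second part `A-T` gives a sign, `T-W` dualises
    -- the word and `T-D-pow` changes x into y.
    L-reflection : ∀ u x y → x + y ≈ 1# → L u (pow x) ≈ L u 𝟙 + L (τ u) (pow y)
    L-reflection u x y x+y≈1 = begin
      L u (pow x)                            ≈⟨ solve 2 (λ a b → a := b :- (b :- a)) refl _ _ ⟩
      L u 𝟙 - (L u 𝟙 - L u (pow x))          ≈⟨ +-congˡ (-‿cong (L-minus u 𝟙 (pow x))) ⟨
      L u 𝟙 - L u (𝟙 ⊝ pow x)                ≈⟨ +-congˡ (A-T N (W u (D (𝟙 ⊝ pow x))) bNN≈1) ⟨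
      L u 𝟙 + A N (T (W u (D (𝟙 ⊝ pow x))))  ≈⟨ +-congˡ (A-cong N (λ {m} m<N → trans (T-W u (D (𝟙 ⊝ pow x)) m<N)
                                                  (W-cong (τ u) m λ i≤m → T-D-pow x y x+y≈1 (ℕ.≤-<-trans i≤m m<N)))) ⟩
      L u 𝟙 + L (τ u) (pow y)                ∎

    -- Reflection at x = 0, y = 1, where `pow 0#` vanishes because its exponents are positive.
    L-τ : ∀ u → L (τ u) 𝟙 ≈ - L u 𝟙
    L-τ u = begin
      L (τ u) 𝟙                              ≈⟨ L-cong (τ u) (λ n → sym (1^ n)) ⟩
      L (τ u) (pow 1#)                       ≈⟨ solve 2 (λ a b → a := (b :+ a) :- b) refl _ _ ⟩
      (L u 𝟙 + L (τ u) (pow 1#)) - L u 𝟙     ≈⟨ +-congʳ (L-reflection u 0# 1# (+-identityˡ 1#)) ⟨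
      -- The zero sequence is written `𝟙 ⊝ 𝟙`, so that linearity of `L` disposes of it.
      L u (pow 0#) - L u 𝟙                   ≈⟨ +-congʳ (L-cong u (λ n → trans (zeroˡ _) (sym (-‿inverseʳ 1#)))) ⟩
      L u (𝟙 ⊝ 𝟙) - L u 𝟙                    ≈⟨ +-congʳ (L-minus u 𝟙 𝟙) ⟩
      (L u 𝟙 - L u 𝟙) - L u 𝟙                ≈⟨ solve 1 (λ a → (a :- a) :- a := :- a) refl _ ⟩
      - L u 𝟙                                ∎
      where
      1^ : ∀ n → pow 1# n ≈ 1#
      1^ zero    = *-identityˡ 1#
      1^ (suc n) = trans (*-identityˡ _) (1^ n)

    -- After reflection, `L u 𝟙` splits into two halves: one cancels, the other becomes the dual
    -- correction by `L-τ`.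
    L-duality : ∀ u x y h → x + y ≈ 1# → h + h ≈ 1# →
      L u (pow x) - h * L u 𝟙 ≈ L (τ u) (pow y) - h * L (τ u) 𝟙
    L-duality u x y h x+y≈1 h+h≈1 = begin
      L u (pow x) - h * L u 𝟙                ≈⟨ +-congʳ (L-reflection u x y x+y≈1) ⟩
      (L u 𝟙 + L (τ u) (pow y)) - h * L u 𝟙  ≈⟨ +-congʳ (+-congʳ (*-identityˡ _)) ⟨
      (1# * L u 𝟙 + L (τ u) (pow y)) - h * L u 𝟙  ≈⟨ +-congʳ (+-congʳ (*-congʳ h+h≈1)) ⟨
      ((h + h) * L u 𝟙 + L (τ u) (pow y)) - h * L u 𝟙
        ≈⟨ solve 3 (λ a b h → ((h :+ h) :* a :+ b) :- h :* a := b :- h :* (:- a)) refl _ _ _ ⟩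
      L (τ u) (pow y) - h * - L u 𝟙          ≈⟨ +-congˡ (-‿cong (*-congˡ (L-τ u))) ⟨
      L (τ u) (pow y) - h * L (τ u) 𝟙        ∎

  -- Summation over the number of leading 1's

  module HarmonicSeries (q : Carrier) (q≈N+1 : q ≈ ι (suc N)) (bNN≈1 : b N N ≈ 1#) where

    -- H s i m = ∑ s(n) r(j₁) ⋯ r(jᵢ) over m > j₁ ≥ ⋯ ≥ jᵢ ≥ n ≥ 0
    H : Sequence → ℕ → ℕ → Carrier
    H s zero    m = ∑< m s
    H s (suc i) m = ∑< m (λ j → r j * H s i (suc j))

    term : Sequence → ℕ → ℕ → Carrier
    term s m i = H s i m * q ^ i

    P : Sequence → ℕ → ℕ → Carrier
    P s K m = ∑< K (term s m)

    P-zero : ∀ s K → P s K 0 ≈ 0#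
    P-zero s K = ∑<-zero K {term s 0} λ { zero → zeroˡ _ ; (suc i) → zeroˡ _ }

    -- Split by whether the outermost variable takes the new value m. If so, the term i = 0
    -- contributes `s m`; in the others, removing one leading 1 leaves a factor `r m * q` and a
    -- truncation lower by one.
    P-suc : ∀ s K m → P s (suc K) (suc m) ≈ P s (suc K) m + s m + (r m * q) * P s K (suc m)
    P-suc s zero    m = begin
      ∑< (suc m) s * 1# + 0#   ≈⟨ +-congʳ (*-congʳ (∑<-suc m s)) ⟩
      (∑< m s + s m) * 1# + 0#
        ≈⟨ solve 3 (λ a b c → (a :+ b) :* con (+ 1) :+ con (+ 0) := (a :* con (+ 1) :+ con (+ 0)) :+ b :+ c :* con (+ 0)) refl _ _ _ ⟩
      (∑< m s * 1# + 0#) + s m + (r m * q) * 0# ∎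
    P-suc s (suc K) m = begin
      P s (2 ℕ.+ K) (suc m)
        ≈⟨ ∑<-suc (suc K) (term s (suc m)) ⟩
      P s (suc K) (suc m) + H s (suc K) (suc m) * q ^ suc K
        ≈⟨ +-cong (P-suc s K m) (*-congʳ (∑<-suc m (λ j → r j * H s K (suc j)))) ⟩
      (P s (suc K) m + s m + (r m * q) * P s K (suc m)) + (H s (suc K) m + r m * H s K (suc m)) * q ^ suc K
        ≈⟨ solve 8 (λ P s r q P′ H H′ z → (P :+ s :+ (r :* q) :* P′) :+ (H :+ r :* H′) :* (q :* z)
             := (P :+ H :* (q :* z)) :+ s :+ (r :* q) :* (P′ :+ H′ :* z)) refl
             _ _ (r m) q _ _ (H s K (suc m)) (q ^ K) ⟩
      (P s (suc K) m + H s (suc K) m * q ^ suc K) + s m + (r m * q) * (P s K (suc m) + H s K (suc m) * q ^ K)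
        ≈⟨ +-cong (+-congʳ (∑<-suc (suc K) (term s m))) (*-congˡ (∑<-suc K (term s (suc m)))) ⟨
      P s (2 ℕ.+ K) m + s m + (r m * q) * P s (suc K) (suc m) ∎

    -- By `b-absorb` the ratio is (m - N)/(m + 1) = 1 - (N + 1)/(m + 1).
    b-suc : ∀ {m} → m < N → b N (suc m) ≈ (1# - r m * q) * b N m
    b-suc {m} m<N = begin
      b N (suc m)                                    ≈⟨ *-identityˡ _ ⟨
      1# * b N (suc m)                               ≈⟨ *-congʳ (r-inverse m<N) ⟨
      (r m * ι (suc m)) * b N (suc m)                ≈⟨ *-assoc _ _ _ ⟩
      r m * (ι (suc m) * b N (suc m))                ≈⟨ *-congˡ (b-absorb N m) ⟩
      r m * ((ι m - ι N) * b N m)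
        ≈⟨ solve 4 (λ r k n b → r :* ((k :- n) :* b) := (r :* (con (+ 1) :+ k) :- r :* (con (+ 1) :+ n)) :* b) refl
             (r m) (ι m) (ι N) (b N m) ⟩
      (r m * ι (suc m) - r m * ι (suc N)) * b N m    ≈⟨ *-congʳ (+-cong (r-inverse m<N) (-‿cong (*-congˡ (sym q≈N+1)))) ⟩
      (1# - r m * q) * b N m                         ∎

    -- With q^(K+1) = 0, `P-suc` reads (1 - r m q) P(m+1) = P(m) + s m. Multiplied by `b N m`, this
    -- telescopes through `b-suc`, without inverting 1 - r m q; at m = N the factor `b N N` is 1.
    P≈A : ∀ s K → q ^ suc K ≈ 0# → P s (suc K) N ≈ A N s
    P≈A s K qᴷ⁺¹≈0 = begin
      P s (suc K) N           ≈⟨ *-identityˡ _ ⟨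
      1# * P s (suc K) N      ≈⟨ *-congʳ bNN≈1 ⟨
      b N N * P s (suc K) N   ≈⟨ partial N ℕ.≤-refl ⟩
      A N s                   ∎
      where
      -- The two truncations differ by a multiple of q^K, which the extra factor `q` kills.
      q*P : ∀ m → q * P s K m ≈ q * P s (suc K) m
      q*P m = begin
        q * P s K m                               ≈⟨ +-identityʳ _ ⟨
        q * P s K m + 0#                          ≈⟨ +-congˡ (trans (*-congˡ qᴷ⁺¹≈0) (zeroʳ _)) ⟨
        q * P s K m + H s K m * (q * q ^ K)       ≈⟨ solve 4 (λ q P H z → q :* P :+ H :* (q :* z) := q :* (P :+ H :* z)) refl _ _ _ _ ⟩
        q * (P s K m + H s K m * q ^ K)           ≈⟨ *-congˡ (∑<-suc K (term s m)) ⟨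
        q * P s (suc K) m                         ∎

      partial : ∀ m → m ≤ N → b N m * P s (suc K) m ≈ ∑< m (b N ⊛ s)
      partial zero    _   = trans (*-congˡ (P-zero s (suc K))) (zeroʳ _)
      partial (suc m) m<N = begin
        b N (suc m) * P s (suc K) (suc m)
          ≈⟨ *-congʳ (b-suc m<N) ⟩
        ((1# - r m * q) * b N m) * P s (suc K) (suc m)
          ≈⟨ solve 4 (λ r q b P → ((con (+ 1) :- r :* q) :* b) :* P := b :* (P :- r :* (q :* P))) refl _ _ _ _ ⟩
        b N m * (P s (suc K) (suc m) - r m * (q * P s (suc K) (suc m)))
          ≈⟨ *-congˡ (+-cong (P-suc s K m) (-‿cong (*-congˡ (sym (q*P (suc m)))))) ⟩
        b N m * ((P s (suc K) m + s m + (r m * q) * P s K (suc m)) - r m * (q * P s K (suc m)))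
          ≈⟨ solve 6 (λ b P s r q P′ → b :* ((P :+ s :+ (r :* q) :* P′) :- r :* (q :* P′)) := b :* P :+ b :* s) refl _ _ _ _ _ _ ⟩
        b N m * P s (suc K) m + b N m * s m
          ≈⟨ +-congʳ (partial m (ℕ.<⇒≤ m<N)) ⟩
        ∑< m (b N ⊛ s) + b N m * s m
          ≈⟨ ∑<-suc m (b N ⊛ s) ⟨
        ∑< (suc m) (b N ⊛ s) ∎

-- Star sums as words in the operators

module StarSums {c ℓ} (R : CommutativeRing c ℓ)
  (recip : ℕ → CommutativeRing.Carrier R) (N : ℕ)
  (recip-inverse : BinomialTransform.Reciprocals R N (recip ∘ suc))
  (recip-^ : BinomialTransform.PowersOfReciprocals R N recip)
  (bNN≈1 : CommutativeRing._≈_ R (BinomialTransform.b R N N) (CommutativeRing.1# R))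
  where
  open CommutativeRing R hiding (zero)
  open BinomialTransform R
  open SemiringExp semiring using (_^_)
  open IntegerCoefficients R
  open InitialSums R
  open StarSum R recip
  open HarmonicOperators R N (recip ∘ suc) recip-inverse public
  open Duality bNN≈1 public
  open SetoidReasoning setoid

  summand : (ℕ → Carrier) → Index → Sequence
  summand g (k ∷ [])     j = recip (suc j ℕ.^ value k) * g (suc j)
  summand g (k ∷ l ∷ ls) j = recip (suc j ℕ.^ value k) * starSum g (suc j) (l ∷ ls)

  starSum≡∑ : ∀ g m k → starSum g m k ≡ ∑< m (summand g k)
  starSum≡∑ g m (k ∷ [])     = ≡.refl
  starSum≡∑ g m (k ∷ l ∷ ls) = ≡.refl

  recip-^1 : ∀ j → recip (suc j ℕ.^ 1) ≡ recip (suc j)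
  recip-^1 j = ≡.cong recip (ℕ.*-identityʳ (suc j))

  summand-increment : ∀ g k {j} → j < N → summand g (increment k) j ≈ recip (suc j) * summand g k j
  summand-increment g (pos v ∷ [])     j<N = trans (*-congʳ (recip-^ v j<N)) (*-assoc _ _ _)
  summand-increment g (pos v ∷ l ∷ ls) j<N = trans (*-congʳ (recip-^ v j<N)) (*-assoc _ _ _)

  -- A letter 0 raises the leading exponent, which is one more division; a letter 1 prepends the
  -- exponent 1, which is a division after a partial sum.
  summand≈W : ∀ g u {j} → j < N → summand g w⁻¹[ u 1] j ≈ W u (D (g ∘ suc)) j
  summand≈W g []      {j} j<N = *-congʳ (reflexive (recip-^1 j))
  summand≈W g (𝟎 ∷ u) {j} j<N = trans (summand-increment g w⁻¹[ u 1] j<N) (*-congˡ (summand≈W g u j<N))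
  summand≈W g (𝟏 ∷ u) {j} j<N = *-cong (reflexive (recip-^1 j)) (begin
    starSum g (suc j) w⁻¹[ u 1]      ≡⟨ starSum≡∑ g (suc j) w⁻¹[ u 1] ⟩
    S (summand g w⁻¹[ u 1]) j        ≈⟨ S-cong j (λ i≤j → summand≈W g u (ℕ.≤-<-trans i≤j j<N)) ⟩
    S (W u (D (g ∘ suc))) j          ∎)

  module GeneratingSeries (q : Carrier) (q≈N+1 : q ≈ ι (suc N)) where
    open HarmonicSeries q q≈N+1 bNN≈1

    starSum≈H : ∀ g u i {m} → m ≤ N → starSum g m (⟨1⟩^ i , w⁻¹[ u 1]) ≈ H (W u (D (g ∘ suc))) i m
    starSum≈H g u zero {m} m≤N = trans (reflexive (starSum≡∑ g m w⁻¹[ u 1]))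
      (∑<-cong m {summand g w⁻¹[ u 1]} {W u (D (g ∘ suc))} λ j<m → summand≈W g u (ℕ.<-≤-trans j<m m≤N))
    starSum≈H g u (suc i) {m} m≤N =
      ∑<-cong m {λ j → recip (suc j ℕ.^ 1) * starSum g (suc j) (⟨1⟩^ i , w⁻¹[ u 1])}
                {λ j → recip (suc j) * H (W u (D (g ∘ suc))) i (suc j)}
        λ {j} j<m → *-cong (reflexive (recip-^1 j)) (starSum≈H g u i (ℕ.<-≤-trans j<m m≤N))

    -- Each leading 1 is one outer sum in `H`, so the left side is `P` and `P≈A` evaluates it.
    ∑-starSum : ∀ g u K → q ^ suc K ≈ 0# →
      ∑< (suc K) (λ i → starSum g N (⟨1⟩^ i , w⁻¹[ u 1]) * q ^ i) ≈ L u (g ∘ suc)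
    ∑-starSum g u K qᴷ⁺¹≈0 = trans
      (∑<-cong (suc K) {λ i → starSum g N (⟨1⟩^ i , w⁻¹[ u 1]) * q ^ i} {term (W u (D (g ∘ suc))) N}
        λ {i} _ → *-congʳ (starSum≈H g u i ℕ.≤-refl))
      (P≈A (W u (D (g ∘ suc))) K qᴷ⁺¹≈0)

    ∑-starSum-minus : ∀ h f g u K → q ^ suc K ≈ 0# →
      ∑< (suc K) (λ i → (starSum f N (⟨1⟩^ i , w⁻¹[ u 1]) - h * starSum g N (⟨1⟩^ i , w⁻¹[ u 1])) * q ^ i)
        ≈ L u (f ∘ suc) - h * L u (g ∘ suc)
    ∑-starSum-minus h f g u K qᴷ⁺¹≈0 = begin
      ∑< (suc K) (λ i → (F i - h * G i) * q ^ i)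
        ≈⟨ ∑<-cong (suc K) {λ i → (F i - h * G i) * q ^ i} {F* ⊝ (λ i → h * G* i)} (λ {i} _ →
             solve 4 (λ a b h z → (a :- h :* b) :* z := a :* z :- h :* (b :* z)) refl (F i) (G i) h (q ^ i)) ⟩
      ∑< (suc K) (F* ⊝ (λ i → h * G* i))
        ≈⟨ ∑<-minus (suc K) F* (λ i → h * G* i) ⟩
      ∑< (suc K) F* - ∑< (suc K) (λ i → h * G* i)
        ≈⟨ +-congˡ (-‿cong (∑<-*ˡ (suc K) h G*)) ⟨
      ∑< (suc K) F* - h * ∑< (suc K) G*
        ≈⟨ +-cong (∑-starSum f u K qᴷ⁺¹≈0) (-‿cong (*-congˡ (∑-starSum g u K qᴷ⁺¹≈0))) ⟩
      L u (f ∘ suc) - h * L u (g ∘ suc) ∎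
      where
      F G F* G* : Sequence
      F i = starSum f N (⟨1⟩^ i , w⁻¹[ u 1])
      G i = starSum g N (⟨1⟩^ i , w⁻¹[ u 1])
      F* i = F i * q ^ i
      G* i = G i * q ^ i

-- Passage to components

-- Taking the component of an element of `𝒜̂` at a single prime does not respect equality there,
-- which ignores finitely many primes. It does preserve the operations on representatives, hence
-- propositional equality.
record StrictHomomorphism {c ℓ c′ ℓ′} (R : CommutativeRing c ℓ) (S : CommutativeRing c′ ℓ′) : Set (c ⊔ c′) where
  private
    module R = CommutativeRing R
    module S = CommutativeRing S
  field
    h      : R.Carrier → S.Carrier
    +-homo : ∀ x y → h (x R.+ y) ≡ h x S.+ h y
    *-homo : ∀ x y → h (x R.* y) ≡ h x S.* h y
    0-homo : h R.0# ≡ S.0#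
    1-homo : h R.1# ≡ S.1#

  private
    module R∑ = SemiringSum R.semiring
    module S∑ = SemiringSum S.semiring
    module R^ = SemiringExp R.semiring
    module S^ = SemiringExp S.semiring
    module R× = SemiringMult R.semiring
    module S× = SemiringMult S.semiring

  sum-homo : ∀ {n} (v : Fin n → R.Carrier) → h (R∑.sum v) ≡ S∑.sum (h ∘ v)
  sum-homo {zero}  v = 0-homo
  sum-homo {suc n} v = ≡.trans (+-homo _ _) (≡.cong (h (v Fin.zero) S.+_) (sum-homo (v ∘ Fin.suc)))

  ^-homo : ∀ x n → h (x R^.^ n) ≡ h x S^.^ n
  ^-homo x zero    = 1-homo
  ^-homo x (suc n) = ≡.trans (*-homo _ _) (≡.cong (h x S.*_) (^-homo x n))

  ×1-homo : ∀ n → h (n R×.× R.1#) ≡ n S×.× S.1#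
  ×1-homo zero    = 0-homo
  ×1-homo (suc n) = ≡.trans (+-homo _ _) (≡.cong₂ S._+_ 1-homo (×1-homo n))

  starSum-homo : ∀ recip {g g′} → (∀ n → h (g n) ≡ g′ n) → ∀ n k →
    h (StarSum.starSum R recip g n k) ≡ StarSum.starSum S (h ∘ recip) g′ n k
  starSum-homo recip {g} {g′} g-homo n (k ∷ ks) = go n k ks
    where
    go : ∀ n k ks → h (StarSum.starSum R recip g n (k ∷ ks)) ≡ StarSum.starSum S (h ∘ recip) g′ n (k ∷ ks)
    go n k [] = ≡.trans
      (sum-homo {n} (λ j → recip (suc (toℕ j) ℕ.^ value k) R.* g (suc (toℕ j))))
      (S∑.sum-cong-≗ {n} λ j → ≡.trans (*-homo _ _)
        (≡.cong (h (recip (suc (toℕ j) ℕ.^ value k)) S.*_) (g-homo (suc (toℕ j)))))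
    go n k (l ∷ ls) = ≡.trans
      (sum-homo {n} (λ j → recip (suc (toℕ j) ℕ.^ value k) R.* StarSum.starSum R recip g (suc (toℕ j)) (l ∷ ls)))
      (S∑.sum-cong-≗ {n} λ j → ≡.trans (*-homo _ _)
        (≡.cong (h (recip (suc (toℕ j) ℕ.^ value k)) S.*_) (go (suc (toℕ j)) l ls)))

-- Integer multiples of 1 and their inverses

module NaturalMultiples {c ℓ} (R : CommutativeRing c ℓ) where
  open CommutativeRing R hiding (zero)
  open SemiringExp semiring using (_^_; ^-homo-*)
  open SemiringMult semiring using (×1-homo-*)
  open IntegerCoefficients R
  open BinomialTransform R using (ι)
  open SetoidReasoning setoid

  ι-^ : ∀ a v → ι a ^ v ≈ ι (a ℕ.^ v)
  ι-^ a zero    = sym (+-identityʳ 1#)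
  ι-^ a (suc v) = trans (*-congˡ (ι-^ a v)) (sym (×1-homo-* a (a ℕ.^ v)))

  ι-nilpotent : ∀ a {n K} → ι (a ℕ.^ n) ≈ 0# → n ≤ K → ι a ^ K ≈ 0#
  ι-nilpotent a {n} {K} aⁿ≈0 n≤K = begin
    ι a ^ K                   ≡⟨ ≡.cong (ι a ^_) (ℕ.m+[n∸m]≡n n≤K) ⟨
    ι a ^ (n ℕ.+ (K ∸ n))     ≈⟨ ^-homo-* (ι a) n (K ∸ n) ⟩
    ι a ^ n * ι a ^ (K ∸ n)   ≈⟨ *-congʳ (trans (ι-^ a n) aⁿ≈0) ⟩
    0# * ι a ^ (K ∸ n)        ≈⟨ zeroˡ _ ⟩
    0#                        ∎

  -- Uniqueness of inverses: multiply `z` by both units and regroup.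
  inverse-* : ∀ x y z a c → x * ι a ≈ 1# → y * ι c ≈ 1# → z * ι (a ℕ.* c) ≈ 1# → z ≈ x * y
  inverse-* x y z a c xa≈1 yc≈1 zac≈1 = begin
    z                                ≈⟨ solve 1 (λ z → z := z :* (con (+ 1) :* con (+ 1))) refl z ⟩
    z * (1# * 1#)                    ≈⟨ *-congˡ (*-cong xa≈1 yc≈1) ⟨
    z * ((x * ι a) * (y * ι c))
      ≈⟨ solve 5 (λ x y z a c → z :* ((x :* a) :* (y :* c)) := (z :* (a :* c)) :* (x :* y)) refl x y z (ι a) (ι c) ⟩
    (z * (ι a * ι c)) * (x * y)      ≈⟨ *-congʳ (*-congˡ (×1-homo-* a c)) ⟨
    (z * ι (a ℕ.* c)) * (x * y)      ≈⟨ *-congʳ zac≈1 ⟩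
    1# * (x * y)                     ≈⟨ *-identityˡ _ ⟩
    x * y                            ∎

  ½+½≈1 : ∀ h → h * ι 2 ≈ 1# → h + h ≈ 1#
  ½+½≈1 h h*2≈1 = trans
    (solve 1 (λ h → h :+ h := h :* (con (+ 1) :+ (con (+ 1) :+ con (+ 0)))) refl h) h*2≈1

  x+[1-x]≈1 : ∀ x → x + (1# - x) ≈ 1#
  x+[1-x]≈1 = solve 1 (λ x → x :+ (con (+ 1) :- x) := con (+ 1)) refl

-- Prime divisibility and parity

∤-small : ∀ {p m} → suc m < p → ¬ p ∣ suc m
∤-small m<p p∣m = ℕ.<⇒≱ m<p (∣⇒≤ p∣m)

∤-^ : ∀ {p a} → Prime p → ¬ p ∣ a → ∀ v → ¬ p ∣ a ℕ.^ v
∤-^ p-prime p∤a zero    p∣1 = ¬prime[1] (≡.subst Prime (∣1⇒≡1 p∣1) p-prime)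
∤-^ {p} {a} p-prime p∤a (suc v) p∣aᵛ⁺¹ with euclidsLemma a (a ℕ.^ v) p-prime p∣aᵛ⁺¹
... | inj₁ p∣a  = p∤a p∣a
... | inj₂ p∣aᵛ = ∤-^ p-prime p∤a v p∣aᵛ

even⊎odd : ∀ n → ∃[ m ] (n ≡ m ℕ.* 2 ⊎ n ≡ suc (m ℕ.* 2))
even⊎odd zero    = 0 , inj₁ ≡.refl
even⊎odd (suc n) with even⊎odd n
... | m , inj₁ n≡2m   = m , inj₂ (≡.cong suc n≡2m)
... | m , inj₂ n≡2m+1 = suc m , inj₁ (≡.cong suc n≡2m+1)

-- This gives the coefficient `b N N` the value 1 at N = p - 1. The excluded prime 2 also has no
-- reciprocal of 2.
prime>2⇒even : ∀ {p} → Prime p → 2 < p → ∃[ m ] p ∸ 1 ≡ m ℕ.* 2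
prime>2⇒even {p} p-prime 2<p with even⊎odd p
... | m , inj₂ p≡2m+1 = m , ≡.cong ℕ.pred p≡2m+1
... | m , inj₁ p≡2m   with prime⇒irreducible p-prime (divides m p≡2m)
...   | inj₂ 2≡p = contradiction 2≡p (ℕ.<⇒≢ 2<p)

-- Partial sums and convergence in the limit ring

-- With summands indexed by Fin K rather than ℕ, the v in series-duality is found by pattern unification;
-- otherwise elements of 𝒜̂ would be compared down to their compatibility proofs, which takes minutes.
Summands : Set
Summands = ∀ K → Fin K → CommutativeRing.Carrier 𝒜̂

partialSum : Summands → ℕ → CommutativeRing.Carrier 𝒜̂
partialSum v K = SemiringSum.sum (CommutativeRing.semiring 𝒜̂) {K} (v K)

stable⇒⟶ : ∀ v s →
  (∀ n {K} → n ≤ K → CommutativeRing._≈_ (𝒜 n) (𝒜̂-Limit.at (partialSum v (suc K)) n) (𝒜̂-Limit.at s n)) →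
  partialSum v 𝒜̂-Limit.⟶ s
-- Stability concerns sums of `suc K` terms with n at most K, so the threshold is `suc n`.
stable⇒⟶ v s stable n = suc n , λ { (suc K) (s≤s n≤K) → stable n n≤K }

-- The identity modulo p^n at one odd prime

module Component (p : ℙ) (2<p : 2 < number p) (n : ℕ) where
  R : CommutativeRing 0ℓ 0ℓ
  R = ℤ/ p ^ n [t]

  open CommutativeRing R hiding (zero)
  open SemiringExp semiring using (_^_)
  open BinomialTransform R using (ι; b; b-even)
  open NaturalMultiples R using (ι-nilpotent; inverse-*; ½+½≈1; x+[1-x]≈1)
  open Polynomial (ℤ/ (number p ℕ.^ n)) using (constant; ∷-cong; 0∷[]≈[]; +ₚ-cong; *ₚ-congˡ)

  N : ℕ
  N = number p ∸ 1

  recip : ℕ → Carrier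
  recip a = Completion.at {p} ((1/ p) a) n

  1+N≡p : suc N ≡ number p
  1+N≡p = ℕ.m+[n∸m]≡n (ℕ.≤-trans (s≤s z≤n) 2<p)

  -- `1/-correct` speaks of constant polynomials, the transform of multiples of `1#`.
  constant-ι : ∀ a → constant (+ a) ≈ ι a
  constant-ι zero    = 0∷[]≈[]
  constant-ι (suc a) = +ₚ-cong {f = constant (+ 1)} {g = constant (+ a)} refl (constant-ι a)

  unit : ∀ {a} → ¬ number p ∣ a → recip a * ι a ≈ 1#
  unit {a} p∤a = trans (*ₚ-congˡ (recip a) (sym (constant-ι a))) (1/-correct p p∤a n)

  ∤-below : ∀ {m} → m < N → ¬ number p ∣ suc m
  ∤-below {m} m<N = ∤-small (≡.subst (suc m <_) 1+N≡p (s≤s m<N))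

  recip-^ : ∀ {m} v → m < N → recip (suc m ℕ.^ suc v) ≈ recip (suc m) * recip (suc m ℕ.^ v)
  recip-^ {m} v m<N = inverse-* (recip (suc m)) (recip (suc m ℕ.^ v)) (recip (suc m ℕ.^ suc v)) (suc m) (suc m ℕ.^ v)
    (unit (∤-below m<N)) (unit (∤-^ (primality p) (∤-below m<N) v)) (unit (∤-^ (primality p) (∤-below m<N) (suc v)))

  bNN≈1 : b N N ≈ 1#
  bNN≈1 = b-even (prime>2⇒even (primality p) 2<p)

  pⁿ≈0 : ι (number p ℕ.^ n) ≈ 0#
  pⁿ≈0 = trans (sym (constant-ι (number p ℕ.^ n))) (trans (∷-cong pⁿ≡0 (refl {[]})) 0∷[]≈[])
    where
    pⁿ≡0 : + (number p ℕ.^ n) ≡ + 0 [mod number p ℕ.^ n ]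
    pⁿ≡0 = congruent (ℤ∣.divides (+ 1) (≡.trans (ℤ.+-identityʳ _) (≡.sym (ℤ.*-identityˡ _))))

  pᴷ≈0 : ∀ {K} → n ≤ K → ι (number p) ^ K ≈ 0#
  pᴷ≈0 = ι-nilpotent (number p) {n} pⁿ≈0

  open StarSums R recip N (unit ∘ ∤-below) recip-^ bNN≈1 public
  open GeneratingSeries (ι (number p)) (reflexive (≡.cong ι (≡.sym 1+N≡p))) public

  open StarSum R recip
  open SemiringSum semiring using (sum-cong-≗)

  private
    module 𝒜̂ = CommutativeRing 𝒜̂
    module ℤ[t]^ = CommutativeRing (ℤ[t]^ p)
    open SemiringExp 𝒜̂.semiring using () renaming (_^_ to _^ᴬ_)

  π-component : ℤ[t]^.Carrier → Carrier
  π-component z = Completion.at {p} z n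

  component : 𝒜̂.Carrier → Carrier
  component z = 𝒜̂-Limit.at z n p

  completionₙ : StrictHomomorphism (ℤ[t]^ p) R
  completionₙ = record
    { h = π-component ; +-homo = λ _ _ → ≡.refl ; *-homo = λ _ _ → ≡.refl ; 0-homo = ≡.refl ; 1-homo = ≡.refl }

  𝒜̂ₙ : StrictHomomorphism 𝒜̂ R
  𝒜̂ₙ = record
    { h = component ; +-homo = λ _ _ → ≡.refl ; *-homo = λ _ _ → ≡.refl ; 0-homo = ≡.refl ; 1-homo = ≡.refl }

  private
    module Completionₙ = StrictHomomorphism completionₙ
    module 𝒜̂ₙ = StrictHomomorphism 𝒜̂ₙ

  £★-component : ∀ k x → component (£★ k x) ≡ starSum (π-component (x p) ^_) N k
  £★-component k x = Completionₙ.starSum-homo (1/ p) (Completionₙ.^-homo (x p)) N k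

  ζ★-component : ∀ k → component (ζ★ k) ≡ starSum (λ _ → 1#) N k
  ζ★-component = Completionₙ.starSum-homo (1/ p) (λ _ → ≡.refl) N

  𝐩^-component : ∀ i → component (𝐩 ^ᴬ i) ≡ ι (number p) ^ i
  𝐩^-component i = ≡.trans (𝒜̂ₙ.^-homo 𝐩 i) (≡.cong (_^ i) (Completionₙ.×1-homo (number p)))

  seriesTerm : Index → ∏ℤ[t]^ → ℕ → Carrier
  seriesTerm k x i =
    (starSum (π-component (x p) ^_) N (⟨1⟩^ i , k) - recip 2 * starSum (λ _ → 1#) N (⟨1⟩^ i , k)) * ι (number p) ^ i

  series-component : ∀ k x i →
    component ((£★ (⟨1⟩^ i , k) x 𝒜̂.- ½ 𝒜̂.* ζ★ (⟨1⟩^ i , k)) 𝒜̂.* 𝐩 ^ᴬ i) ≡ seriesTerm k x i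
  series-component k x i = ≡.cong₂ _*_
    (≡.cong₂ (λ y z → y - recip 2 * z) (£★-component (⟨1⟩^ i , k) x) (ζ★-component (⟨1⟩^ i , k)))
    (𝐩^-component i)

  HasComponents : Index → ∏ℤ[t]^ → Summands → Set
  HasComponents k x v = ∀ K i → component (v K i) ≡ seriesTerm k x (toℕ i)

  -- Modulo p^n the powers of p vanish from exponent n on, so the truncated series has a closed form
  -- independent of `K`.
  partialSum-component : ∀ u x {v} → HasComponents w⁻¹[ u 1] x v → ∀ {K} → n ≤ K →
    component (partialSum v (suc K)) ≈ L u (pow (π-component (x p))) - recip 2 * L u 𝟙
  partialSum-component u x {v} v-components {K} n≤K = trans
    (reflexive (≡.trans (𝒜̂ₙ.sum-homo (v (suc K))) (sum-cong-≗ (v-components (suc K)))))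
    (∑-starSum-minus (recip 2) (π-component (x p) ^_) (λ _ → 1#) u K (pᴷ≈0 (ℕ.m≤n⇒m≤1+n n≤K)))

  duality : ∀ u →
    L u (pow (π-component (𝑡 p))) - recip 2 * L u 𝟙
      ≈ L (τ u) (pow (π-component (1-𝑡 p))) - recip 2 * L (τ u) 𝟙
  duality u = L-duality u (π-component (𝑡 p)) (π-component (1-𝑡 p)) (recip 2)
    (x+[1-x]≈1 (π-component (𝑡 p))) (½+½≈1 (recip 2) (unit (∤-small 2<p)))

  partialSum-stable : ∀ u x {v} → HasComponents w⁻¹[ u 1] x v → ∀ {J K} → n ≤ J → n ≤ K →
    component (partialSum v (suc J)) ≈ component (partialSum v (suc K))
  partialSum-stable u x {v} v-components n≤J n≤K =
    trans (partialSum-component u x {v} v-components n≤J) (sym (partialSum-component u x {v} v-components n≤K))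

  partialSum-duality : ∀ u {v v∨} → HasComponents w⁻¹[ u 1] 𝑡 v → HasComponents w⁻¹[ τ u 1] 1-𝑡 v∨ →
    ∀ {J K} → n ≤ J → n ≤ K → component (partialSum v∨ (suc J)) ≈ component (partialSum v (suc K))
  partialSum-duality u {v} {v∨} v-components v∨-components n≤J n≤K =
    trans (partialSum-component (τ u) 1-𝑡 {v∨} v∨-components n≤J)
      (trans (sym (duality u)) (sym (partialSum-component u 𝑡 {v} v-components n≤K)))

-- Assembly over all primes and exponents

series-duality : ∀ u {k k∨ v v∨} → w⁻¹[ u 1] ≡ k → w⁻¹[ τ u 1] ≡ k∨ →
  (∀ p 2<p n → Component.HasComponents p 2<p n k 𝑡 v) →
  (∀ p 2<p n → Component.HasComponents p 2<p n k∨ 1-𝑡 v∨) →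
  Σ (CommutativeRing.Carrier 𝒜̂) λ s → (partialSum v 𝒜̂-Limit.⟶ s) × (partialSum v∨ 𝒜̂-Limit.⟶ s)
series-duality u {v = v} {v∨} ≡.refl ≡.refl v-components v∨-components =
    s , stable⇒⟶ v s (λ n n≤K → v-stable n n≤K ℕ.≤-refl)
      , stable⇒⟶ v∨ s (λ n n≤K → v∨≈v n n≤K ℕ.≤-refl)
  where
  module 𝒜 n = CommutativeRing (𝒜 n)

  v-stable : ∀ n {J K} → n ≤ J → n ≤ K →
    𝒜._≈_ n (𝒜̂-Limit.at (partialSum v (suc J)) n) (𝒜̂-Limit.at (partialSum v (suc K)) n)
  -- The bound 2 discards the prime 2.
  v-stable n n≤J n≤K = 2 , λ p 2<p →
    Component.partialSum-stable p 2<p n u 𝑡 {v} (v-components p 2<p n) n≤J n≤K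

  v∨≈v : ∀ n {J K} → n ≤ J → n ≤ K →
    𝒜._≈_ n (𝒜̂-Limit.at (partialSum v∨ (suc J)) n) (𝒜̂-Limit.at (partialSum v (suc K)) n)
  v∨≈v n n≤J n≤K = 2 , λ p 2<p →
    Component.partialSum-duality p 2<p n u {v} {v∨} (v-components p 2<p n) (v∨-components p 2<p n) n≤J n≤K

  s : CommutativeRing.Carrier 𝒜̂
  s = record
    { at         = λ n → 𝒜̂-Limit.at (partialSum v (suc n)) n
    ; compatible = λ n → 𝒜.trans n
        -- Reducing level n + 1 leaves a sum of n + 2 terms at level n; by stability it agrees with
        -- the one of n + 1 terms.
        (𝒜̂-Limit.compatible (partialSum v (2 ℕ.+ n)) n)
        (v-stable n (ℕ.n≤1+n n) ℕ.≤-refl)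
    }

theorem1p5 : (k : Index) →
    let open CommutativeRing 𝒜̂
        open SemiringExp semiring using (_^_)
    in ∃[ s ]
      HasSum (λ i → (£★ (⟨1⟩^ i , k) 𝑡 - ½ * ζ★ (⟨1⟩^ i , k)) * 𝐩 ^ i) s
      × HasSum (λ i → (£★ (⟨1⟩^ i , (k ∨)) 1-𝑡 - ½ * ζ★ (⟨1⟩^ i , (k ∨))) * 𝐩 ^ i) s
-- For this word, `w⁻¹[ τ u 1]` is `k ∨` by definition, hence the `≡.refl`.
theorem1p5 k = series-duality (dropLast (w k)) (w⁻¹-w k) ≡.refl
  (λ p 2<p n _ i → Component.series-component p 2<p n k 𝑡 (toℕ i))
  (λ p 2<p n _ i → Component.series-component p 2<p n (k ∨) 1-𝑡 (toℕ i))
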